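{- Let $N\ge 2$, let $n_1\ge 0$ and $n_2,\dots,n_N\ge 1$ be integers, and write $|n|=n_2+\cdots+n_N$ and $|k|=k_2+\cdots+k_N$ for $k=(k_2,\dots,k_N)$. The number of acyclic orientations of the complete $N$-partite graph $K_{n_1,\dots,n_N}$ equals \[ \sum_{(k_2,\dots,k_N)\in[n_2]\times\cdots\times[n_N]} (-1)^{|n|-|k|}\,(1+|k|)^{n_1}\,|k|!\,\prod_{i=2}^N \left\{ {n_i \atop k_i} \right\}, \] where $\left\{ {a \atop b} \right\}$ is the Stirling number of the second kind.
   Context: $K_{n_1,\dots,n_N}$ is the complete multipartite graph whose vertex set is partitioned into parts of sizes $n_1,\dots,n_N$, with two vertices adjacent iff they lie in different parts. An acyclic orientation is an assignment of directions to all edges without directed cycles. $[a]=\{1,\dots,a\}$. -}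

module Defs where

open import Data.Nat as ℕ using (ℕ; zero; suc; _∸_; _≤_)
open import Data.Nat using (_!)
open import Data.Integer as ℤ using (ℤ; +_; -1ℤ; 0ℤ)
open import Data.Fin using (Fin)
open import Data.Bool using (Bool; true)
open import Data.List as List using (List; []; _∷_; length; concatMap; replicate; map; allFin; upTo; foldr)
open import Data.Vec as Vec using (Vec)
open import Data.Product using (_×_; Σ)
open import Data.Sum using (_⊎_)
open import Relation.Binary.PropositionalEquality using (_≡_; _≢_)
open import Relation.Nullary using (¬_)

S₂ : ℕ → ℕ → ℕ
S₂ zero    zero    = 1
S₂ zero    (suc k) = 0
S₂ (suc n) zero    = 0
S₂ (suc n) (suc k) = suc k ℕ.* S₂ n (suc k) ℕ.+ S₂ n k

-- The complete multipartite graph K_{sizes}.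
-- Parts are indexed by Fin N; part i has (lookup sizes i) vertices.
-- Vertices are Fin V, V = size₁ + … + size_N, listed part by part.

partLabels : ∀ {N} → Vec ℕ N → List (Fin N)
partLabels {N} sizes = concatMap (λ i → replicate (Vec.lookup sizes i) i) (allFin N)

V : ∀ {N} → Vec ℕ N → ℕ
V sizes = length (partLabels sizes)

part : ∀ {N} (sizes : Vec ℕ N) → Fin (V sizes) → Fin N
part sizes v = List.lookup (partLabels sizes) v

Adj : ∀ {N} (sizes : Vec ℕ N) → Fin (V sizes) → Fin (V sizes) → Set
Adj sizes u v = part sizes u ≢ part sizes v

-- Orientations: a directed-arc relation given as a Boolean adjacency matrix
-- (arc u v  means the edge {u,v} is directed u → v).

Matrix : ℕ → Set
Matrix m = Vec (Vec Bool m) m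

Arc : ∀ {m} → Matrix m → Fin m → Fin m → Set
Arc O u v = Vec.lookup (Vec.lookup O u) v ≡ true

IsOrientation : ∀ {N} (sizes : Vec ℕ N) → Matrix (V sizes) → Set
IsOrientation sizes O =
  (∀ u v → Adj sizes u v → (Arc O u v ⊎ Arc O v u) × ¬ (Arc O u v × Arc O v u)) ×
  (∀ u v → ¬ Adj sizes u v → ¬ Arc O u v)

data Walk⁺ {m} (O : Matrix m) : Fin m → Fin m → Set where
  one  : ∀ {u v} → Arc O u v → Walk⁺ O u v
  step : ∀ {u w v} → Arc O u w → Walk⁺ O w v → Walk⁺ O u v

Acyclic : ∀ {m} → Matrix m → Set
Acyclic O = ∀ v → ¬ Walk⁺ O v v

AcyclicOrientation : ∀ {N} (sizes : Vec ℕ N) → Matrix (V sizes) → Set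
AcyclicOrientation sizes O = IsOrientation sizes O × Acyclic O

box : List ℕ → List (List ℕ)
box []       = [] ∷ []
box (n ∷ ns) = concatMap (λ k → map (k ∷_) (box ns)) (map suc (upTo n))

sumℤ : List ℤ → ℤ
sumℤ = foldr ℤ._+_ 0ℤ

sumℕ : List ℕ → ℕ
sumℕ = foldr ℕ._+_ 0

prodℕ : List ℕ → ℕ
prodℕ = foldr ℕ._*_ 1

stirProd : List ℕ → List ℕ → ℕ
stirProd (n ∷ ns) (k ∷ ks) = S₂ n k ℕ.* stirProd ns ks
stirProd _        _        = 1

term : ℕ → List ℕ → List ℕ → ℤ
term n₁ ns ks =
  (-1ℤ ℤ.^ (sumℕ ns ∸ sumℕ ks)) ℤ.*
  (+ ((suc (sumℕ ks) ℕ.^ n₁) ℕ.* (sumℕ ks !) ℕ.* stirProd ns ks))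

formula : ℕ → List ℕ → ℤ
formula n₁ ns = sumℤ (map (term n₁ ns) (box ns))

{-# OPTIONS --safe #-}

-- The sources of an acyclic orientation of K_{n_1,…,n_N} all lie in one part
-- i; deleting the set I of sources leaves an acyclic orientation without
-- sources in part i, and every such orientation arises.  Let Φ n be the number
-- of acyclic orientations for part sizes n, and Φ[ i ] n the number of those
-- with no source in part i.  Then
--   Φ n − Φ[ i ] n = Σ_{∅≠I} Φ[ i ] (n − |I| eᵢ),   Σᵢ (Φ n − Φ[ i ] n) = Φ n  (n ≠ 0),
-- and these determine both.  They are solved umbrally: let xᵢ^n stand for the
-- functional g ↦ Σₖ (-1)^(n-k) S₂(n,k) g(k) in the variable kᵢ.  Then Φ n is the
-- value of x₁^n₁⋯x_N^n_N at g(k) = (k₁+⋯+k_N)!, and Φ[ i ] n is obtained by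
-- replacing xᵢ^nᵢ with (xᵢ-1)^nᵢ.  The first recurrence is the binomial theorem;
-- the second holds because xᵢ^n − (xᵢ-1)^n is adjoint to g(k) ↦ k g(k-1), which
-- satisfies the Leibniz rule, and K · (K-1)! = K! for K ≠ 0.  Finally
-- x^n evaluated at k ↦ (k+K)! is (1+K)^n K!, which removes the sum over k₁.
module Submission where

open import Defs
open import Data.Nat using (ℕ; suc; _≤_)
open import Data.Integer using (+_)
open import Data.Fin using (Fin)
open import Data.Vec using (Vec; _∷_; lookup; toList)
open import Data.List using (List; length)
open import Data.List.Membership.Propositional using (_∈_)
open import Data.List.Relation.Unary.Unique.Propositional using (Unique)
open import Data.Product using (Σ; _×_)
open import Function.Bundles using (_⇔_)
open import Relation.Binary.PropositionalEquality using (_≡_)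

open import Data.Bool using (true)
import Data.Bool.Properties as Bool
open import Data.Empty using (⊥-elim) renaming (⊥ to Empty)
open import Data.Fin using (zero; suc; punchIn; punchOut)
open import Data.Fin.Induction using (spo-wellFounded)
open import Data.Fin.Properties as Fin
  using (_≟_; all?; any?; punchIn-injective; punchInᵢ≢i; punchIn-punchOut)
open import Data.Fin.Subset
  using (Subset; inside; outside; _∩_; _─_; ∣_∣; Nonempty; ⊥; ⊤)
  renaming (_∈_ to _∈ₛ_; _∉_ to _∉ₛ_)
open import Data.Fin.Subset.Properties
  using (_∈?_; nonempty?; ⊆-antisym; drop-there; x∈p∩q⁺; x∈p∩q⁻; p∩q⊆p; p∩q⊆q;
         x∈p∧x∉q⇒x∈p─q; p─q⊆p; p─⊥≡p; p∩q≢∅⇒∣p─q∣<∣p∣; x∈p⇒∣p-x∣<∣p∣; Empty-unique;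
         ∣⊥∣≡0; ∈⊤; ∩-identityˡ; ∩-zeroˡ)
open import Data.Integer using (ℤ; 0ℤ; 1ℤ; -1ℤ; _+_; _-_; _*_; _^_)
open import Data.Integer.Properties
  using (+-0-commutativeMonoid; pos-+; pos-*; +-identityˡ; +-identityʳ; +-assoc; +-comm;
         *-identityˡ; *-zeroˡ; *-zeroʳ; *-assoc; *-distribˡ-+; ^-distribˡ-+-*)
open import Data.Integer.Tactic.RingSolver using (solve-∀)
open import Data.List as List using ([]; _∷_; _++_; map; concat; concatMap; replicate; applyUpTo; upTo)
open import Data.List.Membership.Propositional using (find)
open import Data.List.Membership.Propositional.Properties
  using (∈-map⁺; ∈-map⁻; ∈-++⁺ˡ; ∈-++⁺ʳ; ∈-++⁻; ∈-concatMap⁻; ∈-upTo⁻)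
open import Data.List.Properties
  using (length-++; length-map; map-∘; map-id-local; map-tabulate; map-applyUpTo)
import Data.List.Relation.Unary.All as All
open import Data.List.Relation.Unary.Any using (here; there)
open import Data.List.Relation.Unary.Unique.Propositional using ([]; _∷_)
import Data.List.Relation.Unary.Unique.Propositional.Properties as Unique
open import Data.Nat as ℕ using (zero; _<_; _∸_; _!; z≤n; s≤s; s<s⁻¹)
import Data.Nat.Properties as ℕ
open import Data.Product using (∃; _,_; proj₁; proj₂)
open import Data.Sum using (_⊎_; inj₁; inj₂; [_,_]′)
open import Data.Vec using ([]; here; there; tabulate)
open import Data.Vec.Properties
  using (lookup∘tabulate; tabulate∘lookup; tabulate-cong; []=⇒lookup; lookup⇒[]=)
open import Function using (_∘_; mk⇔; Equivalence)
open import Induction.WellFounded using (Acc; acc)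
open import Relation.Binary using (IsStrictPartialOrder)
open import Relation.Binary.PropositionalEquality
  using (_≢_; _≗_; refl; sym; trans; cong; cong₂; subst; isEquivalence; module ≡-Reasoning)
open import Relation.Nullary
  using (¬_; Dec; yes; no; does; contradiction; _×-dec_; _⊎-dec_; ¬?)
open import Relation.Nullary.Decidable using (dec-true; decidable-stable)
open import Relation.Unary using (Decidable)
open import Algebra.Properties.CommutativeMonoid.Sum +-0-commutativeMonoid
  using (sum; sum-cong-≗; sum-remove)

open Equivalence using (to; from)

private
  variable
    m N : ℕ
    A B : Set
    #P #Q : ℤ

-- Linear operators and functionals on integer sequences

record Operator : Set where
  field
    _⟦_⟧   : (ℕ → ℤ) → ℕ → ℤ
    resp   : ∀ {g h} → g ≗ h → _⟦_⟧ g ≗ _⟦_⟧ h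
    linear : ∀ g h c k → _⟦_⟧ (λ j → g j + c * h j) k ≡ _⟦_⟧ g k + c * _⟦_⟧ h k

open Operator using (_⟦_⟧)

-- Sequences are compared pointwise, so `resp` is part of the structure. The one field `linear`
-- yields additivity at c = 1 and homogeneity at g = 0.
record Functional : Set where
  field
    _⟨_⟩   : (ℕ → ℤ) → ℤ
    resp   : ∀ {g h} → g ≗ h → _⟨_⟩ g ≡ _⟨_⟩ h
    linear : ∀ g h c → _⟨_⟩ (λ k → g k + c * h k) ≡ _⟨_⟩ g + c * _⟨_⟩ h

open Functional using (_⟨_⟩)

infix 4 _≈_
_≈_ : Functional → Functional → Set
α ≈ β = ∀ g → α ⟨ g ⟩ ≡ β ⟨ g ⟩

additive : ∀ α g h → α ⟨ (λ k → g k + h k) ⟩ ≡ α ⟨ g ⟩ + α ⟨ h ⟩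
additive α g h = begin
  α ⟨ (λ k → g k + h k) ⟩       ≡⟨ resp (λ k → cong (_+_ (g k)) (*-identityˡ (h k))) ⟨
  α ⟨ (λ k → g k + 1ℤ * h k) ⟩  ≡⟨ linear g h 1ℤ ⟩
  α ⟨ g ⟩ + 1ℤ * α ⟨ h ⟩        ≡⟨ cong (_+_ (α ⟨ g ⟩)) (*-identityˡ _) ⟩
  α ⟨ g ⟩ + α ⟨ h ⟩             ∎
  where open ≡-Reasoning
        open Functional α using (resp; linear)

null : ∀ α → α ⟨ (λ _ → 0ℤ) ⟩ ≡ 0ℤ
-- With c = -1 the argument reduces to the zero sequence again, and the right side cancels.
null α = trans (linear (λ _ → 0ℤ) (λ _ → 0ℤ) -1ℤ) (cancel (α ⟨ (λ _ → 0ℤ) ⟩))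
  where open Functional α using (linear)
        cancel : ∀ x → x + -1ℤ * x ≡ 0ℤ
        cancel = solve-∀

homogeneous : ∀ α c h → α ⟨ (λ k → c * h k) ⟩ ≡ c * α ⟨ h ⟩
homogeneous α c h = begin
  α ⟨ (λ k → c * h k) ⟩       ≡⟨ resp (λ k → +-identityˡ (c * h k)) ⟨
  α ⟨ (λ k → 0ℤ + c * h k) ⟩  ≡⟨ linear (λ _ → 0ℤ) h c ⟩
  α ⟨ (λ _ → 0ℤ) ⟩ + c * α ⟨ h ⟩  ≡⟨ cong (_+ c * α ⟨ h ⟩) (null α) ⟩
  0ℤ + c * α ⟨ h ⟩            ≡⟨ +-identityˡ _ ⟩
  c * α ⟨ h ⟩                 ∎
  where open ≡-Reasoning
        open Functional α using (resp; linear)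

atZero : Functional
atZero = record { _⟨_⟩ = λ g → g 0 ; resp = λ e → e 0 ; linear = λ _ _ _ → refl }

infixl 6 _⊙_
_⊙_ : Functional → Operator → Functional
α ⊙ T = record
  { _⟨_⟩   = λ g → α ⟨ T ⟦ g ⟧ ⟩
  ; resp   = λ e → α.resp (T.resp e)
  ; linear = λ g h c → trans (α.resp (T.linear g h c)) (α.linear (T ⟦ g ⟧) (T ⟦ h ⟧) c)
  }
  where module α = Functional α
        module T = Operator T

-- Products of functionals

shift : ℕ → (ℕ → ℤ) → ℕ → ℤ
shift k g j = g (k ℕ.+ j)

infixr 7 _⊗_
-- All sequences that occur depend only on the sum of the variables, so the tensor product is
-- composed with addition and stays a functional in one variable.
_⊗_ : Functional → Functional → Functional
α ⊗ β = record
  { _⟨_⟩   = λ g → α ⟨ (λ k → β ⟨ shift k g ⟩) ⟩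
  ; resp   = λ e → α.resp λ k → β.resp (e ∘ (k ℕ.+_))
  ; linear = λ g h c → trans (α.resp λ k → β.linear (shift k g) (shift k h) c)
                             (α.linear (λ k → β ⟨ shift k g ⟩) (λ k → β ⟨ shift k h ⟩) c)
  }
  where module α = Functional α
        module β = Functional β

∏ : (Fin N → Functional) → Functional
∏ {zero}  α = atZero
∏ {suc N} α = α zero ⊗ ∏ (α ∘ suc)

-- The factor `α i` is ignored. Recursion on the index, in place of an updated family, lets both
-- clauses compute to products.
∏[_≔_] : Fin N → Functional → (Fin N → Functional) → Functional
∏[ zero  ≔ β ] α = β ⊗ ∏ (α ∘ suc)
∏[ suc i ≔ β ] α = α zero ⊗ ∏[ i ≔ β ] (α ∘ suc)

⊗-cong : ∀ {α α′ β β′} → α ≈ α′ → β ≈ β′ → α ⊗ β ≈ α′ ⊗ β′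
⊗-cong {α} {β′ = β′} α≈ β≈ g =
  trans (Functional.resp α λ k → β≈ (shift k g)) (α≈ (λ k → β′ ⟨ shift k g ⟩))

∏-cong : {α β : Fin N → Functional} → (∀ i → α i ≈ β i) → ∏ α ≈ ∏ β
∏-cong {zero}          e g = refl
∏-cong {suc N} {α} {β} e   =
  ⊗-cong {α zero} {β zero} {∏ (α ∘ suc)} {∏ (β ∘ suc)} (e zero) (∏-cong (e ∘ suc))

∏[≔]-self : (i : Fin N) (α : Fin N → Functional) → ∏[ i ≔ α i ] α ≈ ∏ α
∏[≔]-self zero    α g = refl
∏[≔]-self (suc i) α g = Functional.resp (α zero) λ k → ∏[≔]-self i (α ∘ suc) (shift k g)

∏[≔]-cong : (i : Fin N) {α β : Fin N → Functional} {γ δ : Functional} →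
            (∀ j → j ≢ i → α j ≈ β j) → γ ≈ δ → ∏[ i ≔ γ ] α ≈ ∏[ i ≔ δ ] β
∏[≔]-cong zero {α} {β} {γ} {δ} e e′ =
  ⊗-cong {γ} {δ} {∏ (α ∘ suc)} {∏ (β ∘ suc)} e′ (∏-cong λ j → e (suc j) λ ())
∏[≔]-cong (suc i) {α} {β} {γ} {δ} e e′ =
  ⊗-cong {α zero} {β zero} {∏[ i ≔ γ ] (α ∘ suc)} {∏[ i ≔ δ ] (β ∘ suc)}
    (e zero λ ()) (∏[≔]-cong i (λ j j≢i → e (suc j) (j≢i ∘ λ { refl → refl })) e′)

-- Products are multilinear; this carries the one-variable identities `φ-δ` and `φ-pascal` over to
-- all N variables.
∏[≔]-additive : (i : Fin N) (α : Fin N → Functional) (β γ δ : Functional) →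
                (∀ g → β ⟨ g ⟩ ≡ γ ⟨ g ⟩ + δ ⟨ g ⟩) →
                ∀ g → ∏[ i ≔ β ] α ⟨ g ⟩ ≡ ∏[ i ≔ γ ] α ⟨ g ⟩ + ∏[ i ≔ δ ] α ⟨ g ⟩
∏[≔]-additive zero    α β γ δ e g = e _
∏[≔]-additive (suc i) α β γ δ e g =
  trans (Functional.resp (α zero) λ k → ∏[≔]-additive i (α ∘ suc) β γ δ e (shift k g))
        (additive (α zero) _ _)

-- The operator `δ` and its Leibniz rule

-- Umbrally, δ is the derivative x^k ↦ k x^(k-1).
δ : Operator
δ = record
  -- At k = 0 the default `pred 0` is harmless because of the factor k.
  { _⟦_⟧   = λ g k → + k * g (ℕ.pred k)
  ; resp   = λ e k → cong (+ k *_) (e (ℕ.pred k))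
  ; linear = λ g h c k → identity (+ k) (g (ℕ.pred k)) (h (ℕ.pred k)) c
  }
  where identity : ∀ k x y c → k * (x + c * y) ≡ k * x + c * (k * y)
        identity = solve-∀

-- This and `δ-shift′` bring both Leibniz terms to the value of g at `pred (k + j)`. Where the two
-- uses of `pred` disagree, the coefficient is 0.
δ-shift : ∀ k g → δ ⟦ shift k g ⟧ ≗ λ j → + j * g (ℕ.pred (k ℕ.+ j))
δ-shift k g zero    = refl
δ-shift k g (suc j) = cong (λ x → + suc j * g (ℕ.pred x)) (sym (ℕ.+-suc k j))

δ-shift′ : ∀ k g j → + k * shift (ℕ.pred k) g j ≡ + k * g (ℕ.pred (k ℕ.+ j))
δ-shift′ zero    g j = refl
δ-shift′ (suc k) g j = refl

-- The coefficient in (k + j) g(k + j - 1) splits: k belongs to the outer variable, j to the inner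
-- one.
leibniz-⊗ : ∀ β g k → + k * β ⟨ shift (ℕ.pred k) g ⟩ + β ⟨ δ ⟦ shift k g ⟧ ⟩ ≡ β ⟨ shift k (δ ⟦ g ⟧) ⟩
leibniz-⊗ β g k = begin
  + k * β ⟨ shift (ℕ.pred k) g ⟩ + β ⟨ δ ⟦ shift k g ⟧ ⟩
    ≡⟨ cong (λ x → x + β ⟨ δ ⟦ shift k g ⟧ ⟩) (homogeneous β (+ k) (shift (ℕ.pred k) g)) ⟨
  β ⟨ (λ j → + k * shift (ℕ.pred k) g j) ⟩ + β ⟨ δ ⟦ shift k g ⟧ ⟩
    ≡⟨ additive β _ _ ⟨
  β ⟨ (λ j → + k * shift (ℕ.pred k) g j + (δ ⟦ shift k g ⟧) j) ⟩
    ≡⟨ Functional.resp β (λ j → cong₂ _+_ (δ-shift′ k g j) (δ-shift k g j)) ⟩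
  β ⟨ (λ j → + k * g (ℕ.pred (k ℕ.+ j)) + + j * g (ℕ.pred (k ℕ.+ j))) ⟩
    ≡⟨ Functional.resp β (λ j → trans (distrib (+ k) (+ j) (g (ℕ.pred (k ℕ.+ j))))
                                         (cong (λ x → x * g (ℕ.pred (k ℕ.+ j))) (sym (pos-+ k j)))) ⟩
  β ⟨ shift k (δ ⟦ g ⟧) ⟩ ∎
  where open ≡-Reasoning
        distrib : ∀ a b x → a * x + b * x ≡ (a + b) * x
        distrib = solve-∀

⟨⟩-sum : ∀ α (f : Fin N → ℕ → ℤ) → α ⟨ (λ k → sum (λ i → f i k)) ⟩ ≡ sum (λ i → α ⟨ f i ⟩)
⟨⟩-sum {zero}  α f = null α
⟨⟩-sum {suc N} α f =
  trans (additive α (f zero) _) (cong (_+_ (α ⟨ f zero ⟩)) (⟨⟩-sum α (f ∘ suc)))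

leibniz : (α : Fin N → Functional) (g : ℕ → ℤ) →
          sum (λ i → ∏[ i ≔ α i ⊙ δ ] α ⟨ g ⟩) ≡ ∏ α ⟨ δ ⟦ g ⟧ ⟩
leibniz {zero}  α g = refl
leibniz {suc N} α g = begin
  α₀ ⟨ (λ k → + k * β ⟨ shift (ℕ.pred k) g ⟩) ⟩ + sum (λ i → α₀ ⟨ (λ k → β[ i ] ⟨ shift k g ⟩) ⟩)
    ≡⟨ cong (_+_ (α₀ ⟨ _ ⟩)) (⟨⟩-sum α₀ (λ i k → β[ i ] ⟨ shift k g ⟩)) ⟨
  α₀ ⟨ (λ k → + k * β ⟨ shift (ℕ.pred k) g ⟩) ⟩ + α₀ ⟨ (λ k → sum (λ i → β[ i ] ⟨ shift k g ⟩)) ⟩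
    ≡⟨ additive α₀ _ _ ⟨
  α₀ ⟨ (λ k → + k * β ⟨ shift (ℕ.pred k) g ⟩ + sum (λ i → β[ i ] ⟨ shift k g ⟩)) ⟩
    ≡⟨ resp (λ k → trans (cong (_+_ (+ k * β ⟨ shift (ℕ.pred k) g ⟩)) (leibniz (α ∘ suc) (shift k g)))
                          (leibniz-⊗ β g k)) ⟩
  α₀ ⟨ (λ k → β ⟨ shift k (δ ⟦ g ⟧) ⟩) ⟩ ∎
  where open ≡-Reasoning
        α₀ = α zero
        β  = ∏ (α ∘ suc)
        β[_] : Fin N → Functional
        β[ i ] = ∏[ i ≔ α (suc i) ⊙ δ ] (α ∘ suc)
        open Functional α₀ using (resp)

-- Umbral powers of x and x - 1

-- Umbrally, with x^n ↦ Σₖ s(n,k) g k for the signed Stirling numbers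
-- s(n+1,k) = s(n,k-1) - k s(n,k), the operator X 0 is multiplication by x and
-- X 1 is multiplication by x - 1.
X : ℕ → Operator
X a = record
  { _⟦_⟧   = λ g k → g (suc k) - + (a ℕ.+ k) * g k
  ; resp   = λ e k → cong₂ (λ x y → x - + (a ℕ.+ k) * y) (e (suc k)) (e k)
  ; linear = λ g h c k → identity (+ (a ℕ.+ k)) (g (suc k)) (g k) (h (suc k)) (h k) c
  }
  where identity : ∀ k x y x′ y′ c → (x + c * x′) - k * (y + c * y′) ≡ (x - k * y) + c * (x′ - k * y′)
        identity = solve-∀

-- x^n (x-1)^b
φ : ℕ → ℕ → Functional
φ zero    zero    = atZero
φ zero    (suc b) = φ zero b ⊙ X 1
φ (suc n) b       = φ n b ⊙ X 0

-- This is x = (x - 1) + 1, multiplied by x^n (x - 1)^b.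
φ-pascal : ∀ n b g → φ (suc n) b ⟨ g ⟩ ≡ φ n (suc b) ⟨ g ⟩ + φ n b ⟨ g ⟩
φ-pascal zero b g = begin
  φ 0 b ⟨ X 0 ⟦ g ⟧ ⟩
    ≡⟨ resp (λ k → trans (identity (g (suc k)) (+ k) (g k))
                          (cong (λ x → g (suc k) - x * g k + g k) (sym (pos-+ 1 k)))) ⟩
  φ 0 b ⟨ (λ k → (X 1 ⟦ g ⟧) k + g k) ⟩  ≡⟨ additive (φ 0 b) _ _ ⟩
  φ 0 b ⟨ X 1 ⟦ g ⟧ ⟩ + φ 0 b ⟨ g ⟩          ∎
  where open ≡-Reasoning
        open Functional (φ 0 b) using (resp)
        identity : ∀ x k y → x - k * y ≡ x - (1ℤ + k) * y + y
        identity = solve-∀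
φ-pascal (suc n) b g = φ-pascal n b (X 0 ⟦ g ⟧)

-- Since `X 0` and `X 1` differ by the identity, this is adjoint to the product rule Δ(x f) = f + (x
-- - 1) Δf for the backward difference Δf(x) = f(x) - f(x - 1).
X-δ-commutator : ∀ g k → (X 0 ⟦ g ⟧) k + (δ ⟦ X 1 ⟦ g ⟧ ⟧) k ≡ (X 1 ⟦ g ⟧) k + (X 0 ⟦ δ ⟦ g ⟧ ⟧) k
X-δ-commutator g zero    = identity (g 1) (g 0)
  where identity : ∀ x y → x - + 0 * y + + 0 * (x - 1ℤ * y) ≡ x - 1ℤ * y + (1ℤ * y - + 0 * (+ 0 * y))
        identity = solve-∀
X-δ-commutator g (suc j) = begin
  (x - k * y) + k * (y - k * z)               ≡⟨ identity x y z k ⟩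
  (x - (1ℤ + k) * y) + ((1ℤ + k) * y - k * (k * z))
    ≡⟨ cong (λ l → (x - l * y) + (l * y - k * (k * z))) (pos-+ 1 (suc j)) ⟨
  (x - + suc (suc j) * y) + (+ suc (suc j) * y - k * (k * z)) ∎
  where open ≡-Reasoning
        x = g (suc (suc j))
        y = g (suc j)
        z = g j
        k = + suc j
        identity : ∀ x y z k → (x - k * y) + k * (y - k * z) ≡ (x - (1ℤ + k) * y) + ((1ℤ + k) * y - k * (k * z))
        identity = solve-∀

-- x^n = (x-1)^n + Δ(x^n) for the backward difference Δ, which is adjoint to δ
-- because the s(n,k) are the coordinates of x^n in the rising factorials.
φ-δ : ∀ n g → φ n 0 ⟨ g ⟩ ≡ φ 0 n ⟨ g ⟩ + φ n 0 ⟨ δ ⟦ g ⟧ ⟩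
φ-δ zero    g = sym (+-identityʳ (g 0))
φ-δ (suc n) g = begin
  F (X 0 ⟦ g ⟧)                               ≡⟨ insert (F (X 0 ⟦ g ⟧)) (F (δ ⟦ X 1 ⟦ g ⟧ ⟧)) ⟩
  (F (X 0 ⟦ g ⟧) + F (δ ⟦ X 1 ⟦ g ⟧ ⟧)) - F (δ ⟦ X 1 ⟦ g ⟧ ⟧)
    ≡⟨ cong (_- F (δ ⟦ X 1 ⟦ g ⟧ ⟧)) commute ⟩
  (F (X 1 ⟦ g ⟧) + F (X 0 ⟦ δ ⟦ g ⟧ ⟧)) - F (δ ⟦ X 1 ⟦ g ⟧ ⟧)
    -- The induction hypothesis is taken at `X 1 ⟦ g ⟧`, so its first term is already
    -- `φ 0 (suc n) ⟨ g ⟩`.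
    ≡⟨ cong (λ x → (x + F (X 0 ⟦ δ ⟦ g ⟧ ⟧)) - F (δ ⟦ X 1 ⟦ g ⟧ ⟧)) (φ-δ n (X 1 ⟦ g ⟧)) ⟩
  (φ 0 n ⟨ X 1 ⟦ g ⟧ ⟩ + F (δ ⟦ X 1 ⟦ g ⟧ ⟧) + F (X 0 ⟦ δ ⟦ g ⟧ ⟧)) - F (δ ⟦ X 1 ⟦ g ⟧ ⟧)
    ≡⟨ cancel (φ 0 n ⟨ X 1 ⟦ g ⟧ ⟩) (F (δ ⟦ X 1 ⟦ g ⟧ ⟧)) (F (X 0 ⟦ δ ⟦ g ⟧ ⟧)) ⟩
  φ 0 n ⟨ X 1 ⟦ g ⟧ ⟩ + F (X 0 ⟦ δ ⟦ g ⟧ ⟧)   ∎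
  where
  open ≡-Reasoning
  F : (ℕ → ℤ) → ℤ
  F = φ n 0 ⟨_⟩
  commute : F (X 0 ⟦ g ⟧) + F (δ ⟦ X 1 ⟦ g ⟧ ⟧) ≡ F (X 1 ⟦ g ⟧) + F (X 0 ⟦ δ ⟦ g ⟧ ⟧)
  commute = trans (sym (additive (φ n 0) _ _))
                  (trans (Functional.resp (φ n 0) (X-δ-commutator g)) (additive (φ n 0) _ _))
  insert : ∀ x y → x ≡ (x + y) - y
  insert = solve-∀
  cancel : ∀ x y z → (x + y + z) - y ≡ x + z
  cancel = solve-∀

-- The value g 0 enters `X 0 ⟦ g ⟧` only with coefficient 0; umbrally, x^(n+1) vanishes at x = 0.
φ-cong⁺ : ∀ n {g h} → g ∘ suc ≗ h ∘ suc → φ (suc n) 0 ⟨ g ⟩ ≡ φ (suc n) 0 ⟨ h ⟩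
φ-cong⁺ n {g} {h} e = Functional.resp (φ n 0) lemma
  where lemma : X 0 ⟦ g ⟧ ≗ X 0 ⟦ h ⟧
        lemma zero    = cong (λ x → x - 0ℤ) (e 0)
        lemma (suc k) = cong₂ (λ x y → x - + suc k * y) (e (suc k)) (e k)

-- One positive exponent keeps the total of the variables away from 0, the only place where K · (K -
-- 1)! = K! fails.
∏φ-cong⁺ : (n : Fin N → ℕ) (i : Fin N) → n i ≢ 0 → ∀ {g h} → g ∘ suc ≗ h ∘ suc →
           ∏ (λ j → φ (n j) 0) ⟨ g ⟩ ≡ ∏ (λ j → φ (n j) 0) ⟨ h ⟩
∏φ-cong⁺ n zero    n≢0 {g} {h} e with n zero
... | zero  = contradiction refl n≢0
... | suc m = φ-cong⁺ m {λ k → β ⟨ shift k g ⟩} {λ k → β ⟨ shift k h ⟩} λ k →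
  Functional.resp β (e ∘ (k ℕ.+_))
  where β = ∏ (λ j → φ (n (suc j)) 0)
∏φ-cong⁺ n (suc i) n≢0 {g} {h} e = Functional.resp (φ (n zero) 0) λ k →
  ∏φ-cong⁺ (n ∘ suc) i n≢0 λ j →
    trans (cong g (ℕ.+-suc k j)) (trans (e (k ℕ.+ j)) (cong h (sym (ℕ.+-suc k j))))

-- The counts `Φ` and `Φ[ i ]` and their relations

factorial : ℕ → ℤ
factorial k = + (k !)

-- The number of acyclic orientations for part sizes n, respectively of those
-- in which part i contains no source.
Φ : (Fin N → ℕ) → ℤ
Φ n = ∏ (λ j → φ (n j) 0) ⟨ factorial ⟩

Φ[_] : Fin N → (Fin N → ℕ) → ℤ
Φ[ i ] n = ∏[ i ≔ φ 0 (n i) ] (λ j → φ (n j) 0) ⟨ factorial ⟩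

Φ-cong : {n n′ : Fin N → ℕ} → n ≗ n′ → Φ n ≡ Φ n′
Φ-cong {n = n} {n′} e = ∏-cong {α = α} {β} (λ i g → cong (λ m → φ m 0 ⟨ g ⟩) (e i)) factorial
  where α β : Fin _ → Functional
        α i = φ (n i) 0
        β i = φ (n′ i) 0

Φ-zero : (n : Fin N → ℕ) → (∀ i → n i ≡ 0) → Φ n ≡ 1ℤ
Φ-zero {N} n n≡0 = trans (Φ-cong n≡0) (lemma N)
  where lemma : ∀ N → ∏ {N} (λ _ → φ 0 0) ⟨ factorial ⟩ ≡ 1ℤ
        lemma zero    = refl
        lemma (suc N) = lemma N

-- By `φ-δ` in factor i, the difference `Φ n - Φ[ i ] n` is the i-th term of the Leibniz sum.
Φ[]-split : (i : Fin N) (n : Fin N → ℕ) →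
            Φ n ≡ Φ[ i ] n + ∏[ i ≔ φ (n i) 0 ⊙ δ ] (λ j → φ (n j) 0) ⟨ factorial ⟩
Φ[]-split i n =
  trans (sym (∏[≔]-self i α factorial))
        (∏[≔]-additive i α (α i) (φ 0 (n i)) (α i ⊙ δ) (φ-δ (n i)) factorial)
  where α : Fin _ → Functional
        α j = φ (n j) 0

Φ[]-zero : (i : Fin N) (n : Fin N → ℕ) → n i ≡ 0 → Φ[ i ] n ≡ Φ n
Φ[]-zero i n nᵢ≡0 = begin
  Φ[ i ] n     ≡⟨ cong (λ m → ∏[ i ≔ φ 0 m ] α ⟨ factorial ⟩) nᵢ≡0 ⟩
  ∏[ i ≔ φ 0 0 ] α ⟨ factorial ⟩ ≡⟨ cong (λ m → ∏[ i ≔ φ m 0 ] α ⟨ factorial ⟩) nᵢ≡0 ⟨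
  ∏[ i ≔ α i ] α ⟨ factorial ⟩ ≡⟨ ∏[≔]-self i α factorial ⟩
  Φ n ∎
  where open ≡-Reasoning
        α : Fin _ → Functional
        α j = φ (n j) 0

sum-Φ-Φ[] : (n : Fin N → ℕ) (i : Fin N) → n i ≢ 0 → sum (λ j → Φ n - Φ[ j ] n) ≡ Φ n
sum-Φ-Φ[] n i nᵢ≢0 = begin
  sum (λ j → Φ n - Φ[ j ] n)
    ≡⟨ sum-cong-≗ (λ j → trans (cong (_- Φ[ j ] n) (Φ[]-split j n)) (cancel (Φ[ j ] n) _)) ⟩
  sum (λ j → ∏[ j ≔ α j ⊙ δ ] α ⟨ factorial ⟩)
    ≡⟨ leibniz α factorial ⟩
  ∏ α ⟨ δ ⟦ factorial ⟧ ⟩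
    -- `δ ⟦ factorial ⟧` and `factorial` agree at all positive arguments, but not at 0.
    ≡⟨ ∏φ-cong⁺ n i nᵢ≢0 (λ k → sym (pos-* (suc k) (k !))) ⟩
  Φ n ∎
  where
  open ≡-Reasoning
  α : Fin _ → Functional
  α j = φ (n j) 0
  cancel : ∀ x y → (x + y) - x ≡ y
  cancel = solve-∀

-- On a nonempty vertex set, an orientation without sources in part j starts in exactly one of the
-- other parts, which `punchIn j` lists.
sum-Φ-Φ[]-except : (n : Fin (suc N) → ℕ) (i j : Fin (suc N)) → n i ≢ 0 →
                   sum (λ k → Φ n - Φ[ punchIn j k ] n) ≡ Φ[ j ] n
sum-Φ-Φ[]-except n i j nᵢ≢0 = begin
  rest                                          ≡⟨ insert (Φ n) (Φ[ j ] n) rest ⟩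
  (Φ n - Φ[ j ] n + rest) - (Φ n - Φ[ j ] n)
    ≡⟨ cong (_- (Φ n - Φ[ j ] n)) (sum-remove {i = j} (λ k → Φ n - Φ[ k ] n)) ⟨
  sum (λ k → Φ n - Φ[ k ] n) - (Φ n - Φ[ j ] n) ≡⟨ cong (_- (Φ n - Φ[ j ] n)) (sum-Φ-Φ[] n i nᵢ≢0) ⟩
  Φ n - (Φ n - Φ[ j ] n)                        ≡⟨ cancel (Φ n) (Φ[ j ] n) ⟩
  Φ[ j ] n                                      ∎
  where
  open ≡-Reasoning
  rest = sum (λ k → Φ n - Φ[ punchIn j k ] n)
  insert : ∀ x y z → z ≡ (x - y + z) - (x - y)
  insert = solve-∀
  cancel : ∀ x y → x - (x - y) ≡ y
  cancel = solve-∀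

-- Finite sums over lists

∑ : (A → ℤ) → List A → ℤ
∑ f xs = sumℤ (map f xs)

∑-cong : {f g : A → ℤ} (xs : List A) → (∀ {x} → x ∈ xs → f x ≡ g x) → ∑ f xs ≡ ∑ g xs
∑-cong []       e = refl
∑-cong (x ∷ xs) e = cong₂ _+_ (e (here refl)) (∑-cong xs (e ∘ there))

∑-++ : (f : A → ℤ) (xs ys : List A) → ∑ f (xs ++ ys) ≡ ∑ f xs + ∑ f ys
∑-++ f []       ys = sym (+-identityˡ _)
∑-++ f (x ∷ xs) ys = trans (cong (_+_ (f x)) (∑-++ f xs ys)) (sym (+-assoc (f x) _ _))

∑-concatMap : (f : B → ℤ) (h : A → List B) (xs : List A) →
              ∑ f (concatMap h xs) ≡ ∑ (λ x → ∑ f (h x)) xs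
∑-concatMap f h []       = refl
∑-concatMap f h (x ∷ xs) =
  trans (∑-++ f (h x) (concatMap h xs)) (cong (_+_ (∑ f (h x))) (∑-concatMap f h xs))

∑-map : (f : B → ℤ) (h : A → B) (xs : List A) → ∑ f (map h xs) ≡ ∑ (f ∘ h) xs
∑-map f h xs = cong sumℤ (sym (map-∘ xs))

*-distribˡ-∑ : ∀ c (f : A → ℤ) xs → c * ∑ f xs ≡ ∑ (λ x → c * f x) xs
*-distribˡ-∑ c f []       = *-zeroʳ c
*-distribˡ-∑ c f (x ∷ xs) =
  trans (*-distribˡ-+ c (f x) (∑ f xs)) (cong (_+_ (c * f x)) (*-distribˡ-∑ c f xs))

∑-upTo : (f : ℕ → ℤ) (n : ℕ) → ∑ f (upTo n) ≡ sumℤ (applyUpTo f n)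
∑-upTo f n = cong sumℤ (map-applyUpTo (λ k → k) f n)

∑-upTo-suc : (f : ℕ → ℤ) (n : ℕ) → ∑ f (upTo (suc n)) ≡ f 0 + ∑ (f ∘ suc) (upTo n)
∑-upTo-suc f n = trans (∑-upTo f (suc n)) (cong (_+_ (f 0)) (sym (∑-upTo (f ∘ suc) n)))

∑-zero : (f : ℕ → ℤ) (n : ℕ) → (∀ k → f k ≡ 0ℤ) → ∑ f (upTo n) ≡ 0ℤ
∑-zero f zero    e = refl
∑-zero f (suc n) e = trans (∑-upTo-suc f n) (cong₂ _+_ (e 0) (∑-zero (f ∘ suc) n (e ∘ suc)))

∑-+ : (f g : A → ℤ) (xs : List A) → ∑ (λ x → f x + g x) xs ≡ ∑ f xs + ∑ g xs
∑-+ f g []       = refl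
∑-+ f g (x ∷ xs) =
  trans (cong (_+_ (f x + g x)) (∑-+ f g xs)) (interchange (f x) (g x) (∑ f xs) (∑ g xs))
  where interchange : ∀ a b c d → a + b + (c + d) ≡ (a + c) + (b + d)
        interchange = solve-∀

-- The two ranges differ only in the end terms f 0 and f n.
∑-upTo-shift : (f : ℕ → ℤ) (n : ℕ) → f 0 ≡ 0ℤ → f n ≡ 0ℤ →
               ∑ (f ∘ suc) (upTo n) ≡ ∑ f (upTo n)
∑-upTo-shift f n e₀ eₙ = begin
  ∑ (f ∘ suc) (upTo n)        ≡⟨ +-identityˡ _ ⟨
  0ℤ + ∑ (f ∘ suc) (upTo n)   ≡⟨ cong (λ x → x + ∑ (f ∘ suc) (upTo n)) e₀ ⟨
  f 0 + ∑ (f ∘ suc) (upTo n)  ≡⟨ telescope f n ⟨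
  ∑ f (upTo n) + f n          ≡⟨ cong (_+_ (∑ f (upTo n))) eₙ ⟩
  ∑ f (upTo n) + 0ℤ           ≡⟨ +-identityʳ _ ⟩
  ∑ f (upTo n)                ∎
  where
  open ≡-Reasoning
  telescope : ∀ f n → ∑ f (upTo n) + f n ≡ f 0 + ∑ (f ∘ suc) (upTo n)
  telescope f zero    = +-comm 0ℤ (f 0)
  telescope f (suc n) = begin
    ∑ f (upTo (suc n)) + f (suc n)                 ≡⟨ cong (λ x → x + f (suc n)) (∑-upTo-suc f n) ⟩
    f 0 + ∑ (f ∘ suc) (upTo n) + f (suc n)         ≡⟨ +-assoc (f 0) _ _ ⟩
    f 0 + (∑ (f ∘ suc) (upTo n) + f (suc n))       ≡⟨ cong (_+_ (f 0)) (telescope (f ∘ suc) n) ⟩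
    f 0 + (f 1 + ∑ (f ∘ (2 ℕ.+_)) (upTo n))       ≡⟨ cong (_+_ (f 0)) (∑-upTo-suc (f ∘ suc) n) ⟨
    f 0 + ∑ (f ∘ suc) (upTo (suc n))               ∎

⟨⟩-∑ : ∀ α (w : A → ℤ) (G : A → ℕ → ℤ) xs →
       α ⟨ (λ k → ∑ (λ x → w x * G x k) xs) ⟩ ≡ ∑ (λ x → w x * α ⟨ G x ⟩) xs
⟨⟩-∑ α w G []       = null α
⟨⟩-∑ α w G (x ∷ xs) = trans (additive α _ _) (cong₂ _+_ (homogeneous α (w x) (G x)) (⟨⟩-∑ α w G xs))

-- Expansion of umbral powers in Stirling numbers

S₂-zero : ∀ n k → n < k → S₂ n k ≡ 0
S₂-zero zero    (suc k) _   = refl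
S₂-zero (suc n) (suc k) n<k = begin
  suc k ℕ.* S₂ n (suc k) ℕ.+ S₂ n k
    ≡⟨ cong₂ (λ x y → suc k ℕ.* x ℕ.+ y) (S₂-zero n (suc k) (ℕ.m<n⇒m<1+n (s<s⁻¹ n<k))) (S₂-zero n k (s<s⁻¹ n<k)) ⟩
  suc k ℕ.* 0 ℕ.+ 0                  ≡⟨ cong (ℕ._+ 0) (ℕ.*-zeroʳ k) ⟩
  0                                  ∎
  where open ≡-Reasoning

-- For k > n truncated subtraction gives the sign +1, but then `S₂ n k` is 0.
signedS₂ : ℕ → ℕ → ℤ
signedS₂ n k = -1ℤ ^ (n ∸ k) * + S₂ n k

signedS₂-zero : ∀ n k → n < k → signedS₂ n k ≡ 0ℤ
signedS₂-zero n k n<k =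
  trans (cong (λ x → -1ℤ ^ (n ∸ k) * + x) (S₂-zero n k n<k)) (*-zeroʳ (-1ℤ ^ (n ∸ k)))

signedS₂-suc : ∀ n k → signedS₂ (suc n) (suc k) ≡ signedS₂ n k - + suc k * signedS₂ n (suc k)
signedS₂-suc n k with ℕ.<-≤-connex k n
-- Here `n ∸ k` is one more than `n ∸ suc k`, which accounts for the minus sign of the second term.
... | inj₁ k<n rewrite ℕ.+-∸-assoc 1 k<n = begin
  -1ℤ * ε * + (suc k ℕ.* x ℕ.+ y)
    ≡⟨ cong (λ z → -1ℤ * ε * z) (trans (pos-+ (suc k ℕ.* x) y) (cong (_+ (+ y)) (pos-* (suc k) x))) ⟩
  -1ℤ * ε * (+ suc k * + x + + y)        ≡⟨ identity ε (+ suc k) (+ x) (+ y) ⟩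
  -1ℤ * ε * + y - + suc k * (ε * + x)    ∎
  where open ≡-Reasoning
        ε = -1ℤ ^ (n ∸ suc k)
        x = S₂ n (suc k)
        y = S₂ n k
        identity : ∀ ε k x y → -1ℤ * ε * (k * x + y) ≡ -1ℤ * ε * y - k * (ε * x)
        identity = solve-∀
-- Both exponents truncate to 0 and the signs no longer alternate, but the second term vanishes with
-- `S₂ n (suc k)`.
... | inj₂ n≤k rewrite S₂-zero n (suc k) (s≤s n≤k) = begin
  -1ℤ ^ (n ∸ k) * + (k ℕ.* 0 ℕ.+ S₂ n k)
    ≡⟨ cong (λ x → -1ℤ ^ (n ∸ k) * + (x ℕ.+ S₂ n k)) (ℕ.*-zeroʳ k) ⟩
  -1ℤ ^ (n ∸ k) * + S₂ n k
    ≡⟨ identity (-1ℤ ^ (n ∸ k) * + S₂ n k) (+ suc k) (-1ℤ ^ (n ∸ suc k)) ⟩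
  -1ℤ ^ (n ∸ k) * + S₂ n k - + suc k * (-1ℤ ^ (n ∸ suc k) * 0ℤ) ∎
  where open ≡-Reasoning
        identity : ∀ x k ε → x ≡ x - k * (ε * 0ℤ)
        identity = solve-∀

-- Expanding at `X 0 ⟦ g ⟧` and shifting the index in the terms with k g(k) produces coefficients
-- that satisfy `signedS₂-suc`. The bound n < m makes the end term of the shift vanish.
φ-expand : ∀ n m → n < m → ∀ g → φ n 0 ⟨ g ⟩ ≡ ∑ (λ k → signedS₂ n k * g k) (upTo m)
φ-expand zero (suc m) _ g = sym (begin
  ∑ (λ k → signedS₂ 0 k * g k) (upTo (suc m))
    ≡⟨ ∑-upTo-suc (λ k → signedS₂ 0 k * g k) m ⟩
  1ℤ * g 0 + ∑ (λ k → 0ℤ * g (suc k)) (upTo m)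
    ≡⟨ cong₂ _+_ (*-identityˡ (g 0)) (∑-zero (λ k → 0ℤ * g (suc k)) m (λ k → *-zeroˡ (g (suc k)))) ⟩
  g 0 + 0ℤ                                               ≡⟨ +-identityʳ (g 0) ⟩
  g 0                                                    ∎)
  where open ≡-Reasoning
φ-expand (suc n) (suc m) n<m g = begin
  φ n 0 ⟨ X 0 ⟦ g ⟧ ⟩
    ≡⟨ φ-expand n m (s<s⁻¹ n<m) (X 0 ⟦ g ⟧) ⟩
  ∑ (λ k → signedS₂ n k * (g (suc k) - + k * g k)) (upTo m)
    ≡⟨ ∑-cong (upTo m) (λ {k} _ → expand (signedS₂ n k) (g (suc k)) (+ k) (g k)) ⟩
  ∑ (λ k → signedS₂ n k * g (suc k) + -1ℤ * f k) (upTo m)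
    ≡⟨ ∑-+ (λ k → signedS₂ n k * g (suc k)) (λ k → -1ℤ * f k) (upTo m) ⟩
  ∑ (λ k → signedS₂ n k * g (suc k)) (upTo m) + ∑ (λ k → -1ℤ * f k) (upTo m)
    ≡⟨ cong (_+_ (∑ (λ k → signedS₂ n k * g (suc k)) (upTo m))) (∑-upTo-shift (λ k → -1ℤ * f k) m refl f-last) ⟨
  ∑ (λ k → signedS₂ n k * g (suc k)) (upTo m) + ∑ (λ k → -1ℤ * f (suc k)) (upTo m)
    ≡⟨ ∑-+ (λ k → signedS₂ n k * g (suc k)) (λ k → -1ℤ * f (suc k)) (upTo m) ⟨
  ∑ (λ k → signedS₂ n k * g (suc k) + -1ℤ * f (suc k)) (upTo m)
    ≡⟨ ∑-cong (upTo m) (λ {k} _ → collect k) ⟩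
  ∑ (λ k → signedS₂ (suc n) (suc k) * g (suc k)) (upTo m)            ≡⟨ +-identityˡ _ ⟨
  0ℤ + ∑ (λ k → signedS₂ (suc n) (suc k) * g (suc k)) (upTo m)
    ≡⟨ cong (λ x → x * g 0 + ∑ (λ k → signedS₂ (suc n) (suc k) * g (suc k)) (upTo m)) (*-zeroʳ (-1ℤ ^ suc n)) ⟨
  signedS₂ (suc n) 0 * g 0 + ∑ (λ k → signedS₂ (suc n) (suc k) * g (suc k)) (upTo m)
    ≡⟨ ∑-upTo-suc (λ k → signedS₂ (suc n) k * g k) m ⟨
  ∑ (λ k → signedS₂ (suc n) k * g k) (upTo (suc m))                  ∎
  where
  open ≡-Reasoning
  f : ℕ → ℤ
  f k = + k * (signedS₂ n k * g k)
  expand : ∀ a x k y → a * (x - k * y) ≡ a * x + -1ℤ * (k * (a * y))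
  expand = solve-∀
  f-last : -1ℤ * f m ≡ 0ℤ
  f-last = trans (cong (λ x → -1ℤ * (+ m * (x * g m))) (signedS₂-zero n m (s<s⁻¹ n<m)))
                 (cong (-1ℤ *_) (*-zeroʳ (+ m)))
  factor : ∀ a b k x → a * x + -1ℤ * (k * (b * x)) ≡ (a - k * b) * x
  factor = solve-∀
  collect : ∀ k → signedS₂ n k * g (suc k) + -1ℤ * f (suc k) ≡ signedS₂ (suc n) (suc k) * g (suc k)
  collect k = trans (factor (signedS₂ n k) (signedS₂ n (suc k)) (+ suc k) (g (suc k)))
                    (cong (_* g (suc k)) (sym (signedS₂-suc n k)))

-- For n ≥ 1 the term k = 0 drops out, which leaves exactly the range used in `box`.
φ-stirling : ∀ n → 1 ≤ n → ∀ g → φ n 0 ⟨ g ⟩ ≡ ∑ (λ k → signedS₂ n k * g k) (map suc (upTo n))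
φ-stirling (suc n) _ g = begin
  φ (suc n) 0 ⟨ g ⟩
    ≡⟨ φ-expand (suc n) (2 ℕ.+ n) ℕ.≤-refl g ⟩
  ∑ f (upTo (2 ℕ.+ n))                                         ≡⟨ ∑-upTo-suc f (suc n) ⟩
  signedS₂ (suc n) 0 * g 0 + ∑ (f ∘ suc) (upTo (suc n))
    ≡⟨ cong (λ x → x * g 0 + ∑ (f ∘ suc) (upTo (suc n))) (*-zeroʳ (-1ℤ ^ suc n)) ⟩
  0ℤ + ∑ (f ∘ suc) (upTo (suc n))                              ≡⟨ +-identityˡ _ ⟩
  ∑ (f ∘ suc) (upTo (suc n))                                   ≡⟨ ∑-map f suc (upTo (suc n)) ⟨
  ∑ f (map suc (upTo (suc n)))                                 ∎
  where open ≡-Reasoning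
        f : ℕ → ℤ
        f k = signedS₂ (suc n) k * g k

-- From `Φ` to the explicit formula

∈-map-suc-upTo⁻ : ∀ {n k} → k ∈ map suc (upTo n) → k ≤ n
∈-map-suc-upTo⁻ k∈ with ∈-map⁻ suc k∈
... | _ , j∈ , refl = ∈-upTo⁻ j∈

∈-box⁻ : ∀ ns {ks} → ks ∈ box ns → sumℕ ks ≤ sumℕ ns
∈-box⁻ []       (here refl) = z≤n
∈-box⁻ (n ∷ ns) ks∈
  with k , k∈ , ks∈map ← find (∈-concatMap⁻ (λ k → map (k ∷_) (box ns)) {xs = map suc (upTo n)} ks∈)
  with _ , ks′∈ , refl ← ∈-map⁻ (k ∷_) ks∈map
  = ℕ.+-mono-≤ (∈-map-suc-upTo⁻ k∈) (∈-box⁻ ns ks′∈)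

weight : List ℕ → List ℕ → ℤ
weight ns ks = -1ℤ ^ (sumℕ ns ∸ sumℕ ks) * + stirProd ns ks

∸-+-interchange : ∀ {m n k l} → k ≤ m → l ≤ n → (m ∸ k) ℕ.+ (n ∸ l) ≡ (m ℕ.+ n) ∸ (k ℕ.+ l)
∸-+-interchange {m} {n} {k} {l} k≤m l≤n = begin
  (m ∸ k) ℕ.+ (n ∸ l)     ≡⟨ ℕ.+-∸-assoc (m ∸ k) l≤n ⟨
  ((m ∸ k) ℕ.+ n) ∸ l     ≡⟨ cong (_∸ l) (ℕ.+-∸-comm n k≤m) ⟨
  (m ℕ.+ n) ∸ k ∸ l       ≡⟨ ℕ.∸-+-assoc (m ℕ.+ n) k l ⟩
  (m ℕ.+ n) ∸ (k ℕ.+ l)   ∎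
  where open ≡-Reasoning

-- The two bounds exclude truncation, so the exponents of -1 add up.
weight-∷ : ∀ n k ns ks → k ≤ n → sumℕ ks ≤ sumℕ ns →
           signedS₂ n k * weight ns ks ≡ weight (n ∷ ns) (k ∷ ks)
weight-∷ n k ns ks k≤n K≤N = begin
  a * + x * (b * + y)      ≡⟨ identity a (+ x) b (+ y) ⟩
  a * b * (+ x * + y)
    ≡⟨ cong₂ _*_ (sym (^-distribˡ-+-* -1ℤ (n ∸ k) (sumℕ ns ∸ sumℕ ks))) (sym (pos-* x y)) ⟩
  -1ℤ ^ ((n ∸ k) ℕ.+ (sumℕ ns ∸ sumℕ ks)) * + (x ℕ.* y)
    ≡⟨ cong (λ m → -1ℤ ^ m * + (x ℕ.* y)) (∸-+-interchange k≤n K≤N) ⟩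
  weight (n ∷ ns) (k ∷ ks) ∎
  where open ≡-Reasoning
        a = -1ℤ ^ (n ∸ k)
        b = -1ℤ ^ (sumℕ ns ∸ sumℕ ks)
        x = S₂ n k
        y = stirProd ns ks
        identity : ∀ a x b y → a * x * (b * y) ≡ a * b * (x * y)
        identity = solve-∀

∏φ-box : (ns : Vec ℕ N) → (∀ i → 1 ≤ lookup ns i) → ∀ g →
         ∏ (λ i → φ (lookup ns i) 0) ⟨ g ⟩ ≡
         ∑ (λ ks → weight (toList ns) ks * g (sumℕ ks)) (box (toList ns))
∏φ-box []       1≤ns g = sym (trans (+-identityʳ _) (*-identityˡ (g 0)))
∏φ-box (n ∷ ns) 1≤ns g = begin
  φ n 0 ⟨ (λ k → ∏ (λ i → φ (lookup ns i) 0) ⟨ shift k g ⟩) ⟩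
    ≡⟨ Functional.resp (φ n 0) (λ k → ∏φ-box ns (1≤ns ∘ suc) (shift k g)) ⟩
  φ n 0 ⟨ (λ k → ∑ (λ ks → weight ns′ ks * g (k ℕ.+ sumℕ ks)) (box ns′)) ⟩
    ≡⟨ φ-stirling n (1≤ns zero) _ ⟩
  ∑ (λ k → signedS₂ n k * ∑ (λ ks → weight ns′ ks * g (k ℕ.+ sumℕ ks)) (box ns′)) (map suc (upTo n))
    ≡⟨ ∑-cong (map suc (upTo n)) (λ {k} k∈ → trans (*-distribˡ-∑ (signedS₂ n k) _ (box ns′))
         (∑-cong (box ns′) λ {ks} ks∈ →
           trans (sym (*-assoc (signedS₂ n k) (weight ns′ ks) _))
                 (cong (_* g (k ℕ.+ sumℕ ks))
                       (weight-∷ n k ns′ ks (∈-map-suc-upTo⁻ k∈) (∈-box⁻ ns′ ks∈))))) ⟩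
  ∑ (λ k → ∑ (F ∘ (k ∷_)) (box ns′)) (map suc (upTo n))
    ≡⟨ ∑-cong (map suc (upTo n)) (λ {k} _ → ∑-map F (k ∷_) (box ns′)) ⟨
  ∑ (λ k → ∑ F (map (k ∷_) (box ns′))) (map suc (upTo n))
    ≡⟨ ∑-concatMap F (λ k → map (k ∷_) (box ns′)) (map suc (upTo n)) ⟨
  ∑ F (box (n ∷ ns′)) ∎
  where
  open ≡-Reasoning
  ns′ = toList ns
  F : List ℕ → ℤ
  F ks = weight (n ∷ ns′) ks * g (sumℕ ks)

-- The sequence k ↦ (k + j)! is an eigenvector of `X 0` with eigenvalue 1 + j, because (k + 1 + j)!
-- - k (k + j)! = (1 + j) (k + j)!. Its value at k = 0 is j!.
φ-factorial : ∀ n j → φ n 0 ⟨ (λ k → factorial (k ℕ.+ j)) ⟩ ≡ + (suc j ℕ.^ n ℕ.* j !)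
φ-factorial zero    j = cong +_ (sym (ℕ.+-identityʳ (j !)))
φ-factorial (suc n) j = begin
  φ n 0 ⟨ X 0 ⟦ (λ k → factorial (k ℕ.+ j)) ⟧ ⟩    ≡⟨ Functional.resp (φ n 0) rising ⟩
  φ n 0 ⟨ (λ k → + suc j * factorial (k ℕ.+ j)) ⟩  ≡⟨ homogeneous (φ n 0) (+ suc j) _ ⟩
  + suc j * φ n 0 ⟨ (λ k → factorial (k ℕ.+ j)) ⟩  ≡⟨ cong (+ suc j *_) (φ-factorial n j) ⟩
  + suc j * + (suc j ℕ.^ n ℕ.* j !)                ≡⟨ pos-* (suc j) _ ⟨
  + (suc j ℕ.* (suc j ℕ.^ n ℕ.* j !))
    ≡⟨ cong +_ (ℕ.*-assoc (suc j) (suc j ℕ.^ n) (j !)) ⟨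
  + (suc j ℕ.^ suc n ℕ.* j !)                      ∎
  where
  open ≡-Reasoning
  identity : ∀ k j x → (1ℤ + (k + j)) * x - k * x ≡ (1ℤ + j) * x
  identity = solve-∀
  rising : ∀ k → factorial (suc k ℕ.+ j) - + k * factorial (k ℕ.+ j) ≡ + suc j * factorial (k ℕ.+ j)
  rising k = begin
    + (suc (k ℕ.+ j) ℕ.* (k ℕ.+ j) !) - + k * x
      ≡⟨ cong (_- + k * x) (pos-* (suc (k ℕ.+ j)) ((k ℕ.+ j) !)) ⟩
    + suc (k ℕ.+ j) * x - + k * x
      ≡⟨ cong (λ l → l * x - + k * x) (trans (pos-+ 1 (k ℕ.+ j)) (cong (_+_ 1ℤ) (pos-+ k j))) ⟩
    (1ℤ + (+ k + + j)) * x - + k * x             ≡⟨ identity (+ k) (+ j) x ⟩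
    (1ℤ + + j) * x                               ≡⟨ cong (_* x) (pos-+ 1 j) ⟨
    + suc j * x                                  ∎
    where x = factorial (k ℕ.+ j)

-- Only the factors of `ns` are expanded in Stirling numbers. The first factor is evaluated in
-- closed form by `φ-factorial`, which also covers n₁ = 0.
Φ-formula : ∀ n₁ (ns : Vec ℕ N) → (∀ i → 1 ≤ lookup ns i) →
            Φ (lookup (n₁ ∷ ns)) ≡ formula n₁ (toList ns)
Φ-formula n₁ ns 1≤ns = begin
  φ n₁ 0 ⟨ (λ k → ∏ (λ i → φ (lookup ns i) 0) ⟨ shift k factorial ⟩) ⟩
    ≡⟨ Functional.resp (φ n₁ 0) (λ k → ∏φ-box ns 1≤ns (shift k factorial)) ⟩
  φ n₁ 0 ⟨ (λ k → ∑ (λ ks → weight ns′ ks * factorial (k ℕ.+ sumℕ ks)) (box ns′)) ⟩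
    ≡⟨ ⟨⟩-∑ (φ n₁ 0) (weight ns′) (λ ks k → factorial (k ℕ.+ sumℕ ks)) (box ns′) ⟩
  ∑ (λ ks → weight ns′ ks * φ n₁ 0 ⟨ (λ k → factorial (k ℕ.+ sumℕ ks)) ⟩) (box ns′)
    ≡⟨ ∑-cong (box ns′) (λ {ks} _ → lemma ks) ⟩
  formula n₁ (toList ns) ∎
  where
  open ≡-Reasoning
  ns′ = toList ns
  identity : ∀ a x y → a * x * y ≡ a * (y * x)
  identity = solve-∀
  lemma : ∀ ks → weight ns′ ks * φ n₁ 0 ⟨ (λ k → factorial (k ℕ.+ sumℕ ks)) ⟩ ≡ term n₁ ns′ ks
  lemma ks = begin
    weight ns′ ks * φ n₁ 0 ⟨ _ ⟩      ≡⟨ cong (weight ns′ ks *_) (φ-factorial n₁ (sumℕ ks)) ⟩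
    weight ns′ ks * + a
      ≡⟨ identity (-1ℤ ^ (sumℕ ns′ ∸ sumℕ ks)) (+ stirProd ns′ ks) (+ a) ⟩
    -1ℤ ^ (sumℕ ns′ ∸ sumℕ ks) * (+ a * + stirProd ns′ ks)
      ≡⟨ cong (-1ℤ ^ (sumℕ ns′ ∸ sumℕ ks) *_) (pos-* a _) ⟨
    term n₁ ns′ ks ∎
    where a = suc (sumℕ ks) ℕ.^ n₁ ℕ.* sumℕ ks !

-- Enumerations of predicates

Enumeration : (A → Set) → ℤ → Set
Enumeration {A} P n =
  -- The count is an integer, so it can be equated with differences such as `Φ n - Φ[ i ] n` before
  -- these are known to be nonnegative.
  Σ (List A) λ L → Unique L × (∀ x → (x ∈ L) ⇔ P x) × (+ length L ≡ n)

module _ {P Q : A → Set} where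

  enum-cong : #P ≡ #Q → (∀ a → P a ⇔ Q a) → Enumeration P #P → Enumeration Q #Q
  enum-cong #P≡#Q P⇔Q (L , L! , L⇔P , ∣L∣) =
    L , L! , (λ a → mk⇔ (to (P⇔Q a) ∘ to (L⇔P a)) (from (L⇔P a) ∘ from (P⇔Q a))) , trans ∣L∣ #P≡#Q

  enum-⊎ : Enumeration P #P → Enumeration Q #Q → (∀ {a} → P a → ¬ Q a) →
           Enumeration (λ a → P a ⊎ Q a) (#P + #Q)
  enum-⊎ (K , K! , K⇔P , ∣K∣) (L , L! , L⇔Q , ∣L∣) P#Q =
    K ++ L ,
    Unique.++⁺ K! L! (λ (a∈K , a∈L) → P#Q (to (K⇔P _) a∈K) (to (L⇔Q _) a∈L)) ,
    (λ a → mk⇔ ([ inj₁ ∘ to (K⇔P a) , inj₂ ∘ to (L⇔Q a) ]′ ∘ ∈-++⁻ K)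
               [ ∈-++⁺ˡ ∘ from (K⇔P a) , ∈-++⁺ʳ K ∘ from (L⇔Q a) ]′) ,
    trans (cong +_ (length-++ K)) (trans (pos-+ (length K) (length L)) (cong₂ _+_ ∣K∣ ∣L∣))

enum-∅ : {P : A → Set} → (∀ a → ¬ P a) → Enumeration P 0ℤ
enum-∅ ¬P = [] , [] , (λ a → mk⇔ (λ ()) (λ Pa → contradiction Pa (¬P a))) , refl

enum-singleton : (a : A) → Enumeration (_≡ a) 1ℤ
enum-singleton a = a ∷ [] , (All.[] ∷ []) , (λ b → mk⇔ (λ { (here b≡a) → b≡a }) here) , refl

-- A left inverse on `P` is enough: `map g` takes the image list back to `L`, and a list whose image
-- has no duplicates has none itself.
enum-image : {P : A → Set} (f : A → B) (g : B → A) → (∀ {a} → P a → g (f a) ≡ a) →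
             Enumeration P #P → Enumeration (λ b → ∃ λ a → P a × b ≡ f a) #P
enum-image {P = P} f g g∘f (L , L! , L⇔P , ∣L∣) =
  map f L ,
  Unique.map⁻ {f = g} (subst Unique (sym map-g-f) L!) ,
  (λ b → mk⇔ (λ b∈ → let a , a∈L , b≡fa = ∈-map⁻ f b∈ in a , to (L⇔P a) a∈L , b≡fa)
             (λ { (a , Pa , refl) → ∈-map⁺ f (from (L⇔P a) Pa) })) ,
  trans (cong +_ (length-map f L)) ∣L∣
  where
  map-g-f : map g (map f L) ≡ L
  map-g-f = trans (sym (map-∘ L)) (map-id-local (All.tabulate λ a∈L → g∘f (to (L⇔P _) a∈L)))

enum-Fin : (P : Fin N → A → Set) (c : Fin N → ℤ) → (∀ i → Enumeration (P i) (c i)) →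
           (∀ {i j a} → P i a → P j a → i ≡ j) → Enumeration (λ a → ∃ λ i → P i a) (sum c)
enum-Fin {zero}  P c e disj = enum-∅ λ { a (() , _) }
enum-Fin {suc N} P c e disj =
  enum-cong refl
    (λ a → mk⇔ [ (zero ,_) , (λ (i , Pia) → suc i , Pia) ]′
               (λ { (zero , Pa) → inj₁ Pa ; (suc i , Pa) → inj₂ (i , Pa) }))
    (enum-⊎ (e zero)
            (enum-Fin (P ∘ suc) (c ∘ suc) (e ∘ suc) (λ Pa Qa → Fin.suc-injective (disj Pa Qa)))
            (λ Pa (_ , Qa) → Fin.0≢1+n (disj Pa Qa)))

-- Sums and disjoint unions over subsets

∑⊆ : Subset m → (Subset m → ℤ) → ℤ
∑⊆ []            c = c []
∑⊆ (outside ∷ T) c = ∑⊆ T (c ∘ (outside ∷_))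
∑⊆ (inside  ∷ T) c = ∑⊆ T (c ∘ (inside ∷_)) + ∑⊆ T (c ∘ (outside ∷_))

∑⊆⁺ : Subset m → (Subset m → ℤ) → ℤ
∑⊆⁺ []            c = 0ℤ
∑⊆⁺ (outside ∷ T) c = ∑⊆⁺ T (c ∘ (outside ∷_))
-- Once the first element is chosen the rest is arbitrary; otherwise the rest has to be nonempty.
∑⊆⁺ (inside  ∷ T) c = ∑⊆ T (c ∘ (inside ∷_)) + ∑⊆⁺ T (c ∘ (outside ∷_))

∑⊆-∑⊆⁺ : (T : Subset m) (c : Subset m → ℤ) → ∑⊆ T c ≡ ∑⊆⁺ T c + c ⊥
∑⊆-∑⊆⁺ []            c = sym (+-identityˡ (c []))
∑⊆-∑⊆⁺ (outside ∷ T) c = ∑⊆-∑⊆⁺ T (c ∘ (outside ∷_))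
∑⊆-∑⊆⁺ (inside ∷ T)  c =
  trans (cong (_+_ (∑⊆ T (c ∘ (inside ∷_)))) (∑⊆-∑⊆⁺ T (c ∘ (outside ∷_))))
        (sym (+-assoc (∑⊆ T (c ∘ (inside ∷_))) _ _))

-- Unlike _⊆_, with an explicit argument, so that it can be a component of a pair.
infix 4 _⊑_
_⊑_ : Subset m → Subset m → Set
I ⊑ T = ∀ v → v ∈ₛ I → v ∈ₛ T

outside-⊑ : ∀ {s} {I T : Subset m} → I ⊑ T → outside ∷ I ⊑ s ∷ T
outside-⊑ I⊑T (suc v) (there v∈I) = there (I⊑T v v∈I)

inside-⊑ : {I T : Subset m} → I ⊑ T → inside ∷ I ⊑ inside ∷ T
inside-⊑ I⊑T zero    here        = here
inside-⊑ I⊑T (suc v) (there v∈I) = there (I⊑T v v∈I)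

drop-⊑ : ∀ {s t} {I T : Subset m} → s ∷ I ⊑ t ∷ T → I ⊑ T
drop-⊑ I⊑T v v∈I = drop-there (I⊑T (suc v) (there v∈I))

inside⋢outside : {I T : Subset m} → ¬ (inside ∷ I ⊑ outside ∷ T)
inside⋢outside I⊑T with () ← I⊑T zero here

∑⊆-cong : (T : Subset m) {c d : Subset m → ℤ} → (∀ {I} → I ⊑ T → c I ≡ d I) → ∑⊆ T c ≡ ∑⊆ T d
∑⊆-cong []            e = e λ _ ()
∑⊆-cong (outside ∷ T) e = ∑⊆-cong T (λ I⊑T → e (outside-⊑ I⊑T))
∑⊆-cong (inside ∷ T)  e = cong₂ _+_ (∑⊆-cong T (λ I⊑T → e (inside-⊑ I⊑T)))
                                    (∑⊆-cong T (λ I⊑T → e (outside-⊑ I⊑T)))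

-- The binomial theorem by subsets. With E t b the value of x^t (x - 1)^b, each element of T
-- contributes x = (x - 1) + 1: it either stays in `T ─ I`, giving x - 1, or goes into I, giving 1.
-- The argument b collects the factors x - 1 already chosen.
∑⊆-pascal : (E : ℕ → ℕ → ℤ) → (∀ t b → E (suc t) b ≡ E t (suc b) + E t b) →
            ∀ (T : Subset m) b → ∑⊆ T (λ I → E 0 (b ℕ.+ ∣ T ─ I ∣)) ≡ E (∣ T ∣) b
∑⊆-pascal E pascal []            b = cong (E 0) (ℕ.+-identityʳ b)
∑⊆-pascal E pascal (outside ∷ T) b = ∑⊆-pascal E pascal T b
∑⊆-pascal E pascal (inside ∷ T)  b = begin
  ∑⊆ T (λ I → E 0 (b ℕ.+ ∣ T ─ I ∣)) + ∑⊆ T (λ I → E 0 (b ℕ.+ suc ∣ T ─ I ∣))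
    ≡⟨ cong₂ _+_ (∑⊆-pascal E pascal T b)
                 (trans (∑⊆-cong T λ {I} _ → cong (E 0) (ℕ.+-suc b ∣ T ─ I ∣))
                        (∑⊆-pascal E pascal T (suc b))) ⟩
  E t b + E t (suc b)  ≡⟨ +-comm (E t b) (E t (suc b)) ⟩
  E t (suc b) + E t b  ≡⟨ pascal t b ⟨
  E (suc t) b          ∎
  where open ≡-Reasoning
        t = ∣ T ∣

∷-injectiveʳ : ∀ {s} {I J : Subset m} → s ∷ I ≡ s ∷ J → I ≡ J
∷-injectiveʳ refl = refl

inside≢outside : {I J : Subset m} → inside ∷ I ≢ outside ∷ J
inside≢outside ()

enum-⊆ : (T : Subset m) (P : Subset m → A → Set) (c : Subset m → ℤ) →
         (∀ I → I ⊑ T → Enumeration (P I) (c I)) →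
         (∀ {I J a} → I ⊑ T → J ⊑ T → P I a → P J a → I ≡ J) →
         Enumeration (λ a → ∃ λ I → I ⊑ T × P I a) (∑⊆ T c)
enum-⊆ [] P c e disj =
  enum-cong refl (λ a → mk⇔ (λ Pa → [] , (λ _ ()) , Pa) (λ { ([] , _ , Pa) → Pa })) (e [] λ _ ())
enum-⊆ (outside ∷ T) P c e disj =
  enum-cong refl
    (λ a → mk⇔ (λ (I , I⊑T , Pa) → outside ∷ I , outside-⊑ I⊑T , Pa)
               (λ { (outside ∷ I , I⊑T , Pa) → I , drop-⊑ I⊑T , Pa
                  ; (inside ∷ I , I⊑T , Pa) → contradiction I⊑T inside⋢outside }))
    (enum-⊆ T (P ∘ (outside ∷_)) (c ∘ (outside ∷_)) (λ I I⊑T → e _ (outside-⊑ I⊑T))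
      (λ I⊑T J⊑T Pa Qa → ∷-injectiveʳ (disj (outside-⊑ I⊑T) (outside-⊑ J⊑T) Pa Qa)))
enum-⊆ (inside ∷ T) P c e disj =
  enum-cong refl
    (λ a → mk⇔ [ (λ (I , I⊑T , Pa) → inside ∷ I , inside-⊑ I⊑T , Pa)
               , (λ (I , I⊑T , Pa) → outside ∷ I , outside-⊑ I⊑T , Pa) ]′
               (λ { (inside ∷ I , I⊑T , Pa) → inj₁ (I , drop-⊑ I⊑T , Pa)
                  ; (outside ∷ I , I⊑T , Pa) → inj₂ (I , drop-⊑ I⊑T , Pa) }))
    (enum-⊎
      (enum-⊆ T (P ∘ (inside ∷_)) (c ∘ (inside ∷_)) (λ I I⊑T → e _ (inside-⊑ I⊑T))
        (λ I⊑T J⊑T Pa Qa → ∷-injectiveʳ (disj (inside-⊑ I⊑T) (inside-⊑ J⊑T) Pa Qa)))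
      (enum-⊆ T (P ∘ (outside ∷_)) (c ∘ (outside ∷_)) (λ I I⊑T → e _ (outside-⊑ I⊑T))
        (λ I⊑T J⊑T Pa Qa → ∷-injectiveʳ (disj (outside-⊑ I⊑T) (outside-⊑ J⊑T) Pa Qa)))
      (λ (I , I⊑T , Pa) (J , J⊑T , Qa) → inside≢outside (disj (inside-⊑ I⊑T) (outside-⊑ J⊑T) Pa Qa)))

infix 4 _⊑⁺_
_⊑⁺_ : Subset m → Subset m → Set
I ⊑⁺ T = I ⊑ T × Nonempty I

outside-⊑⁺ : ∀ {s} {I T : Subset m} → I ⊑⁺ T → outside ∷ I ⊑⁺ s ∷ T
outside-⊑⁺ (I⊑T , v , v∈I) = outside-⊑ I⊑T , suc v , there v∈I

inside-⊑⁺ : {I T : Subset m} → I ⊑ T → inside ∷ I ⊑⁺ inside ∷ T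
inside-⊑⁺ I⊑T = inside-⊑ I⊑T , zero , here

drop-outside-⊑⁺ : ∀ {s} {I T : Subset m} → outside ∷ I ⊑⁺ s ∷ T → I ⊑⁺ T
drop-outside-⊑⁺ (I⊑T , suc v , there v∈I) = drop-⊑ I⊑T , v , v∈I

enum-⊆⁺ : (T : Subset m) (P : Subset m → A → Set) (c : Subset m → ℤ) →
          (∀ I → I ⊑⁺ T → Enumeration (P I) (c I)) →
          (∀ {I J a} → I ⊑⁺ T → J ⊑⁺ T → P I a → P J a → I ≡ J) →
          Enumeration (λ a → ∃ λ I → I ⊑⁺ T × P I a) (∑⊆⁺ T c)
enum-⊆⁺ [] P c e disj = enum-∅ λ { a ([] , (_ , () , _) , _) }
enum-⊆⁺ (outside ∷ T) P c e disj =
  enum-cong refl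
    (λ a → mk⇔ (λ (I , I⊑T , Pa) → outside ∷ I , outside-⊑⁺ I⊑T , Pa)
               (λ { (outside ∷ I , I⊑T , Pa) → I , drop-outside-⊑⁺ I⊑T , Pa
                  ; (inside ∷ I , I⊑T , Pa) → contradiction (proj₁ I⊑T) inside⋢outside }))
    (enum-⊆⁺ T (P ∘ (outside ∷_)) (c ∘ (outside ∷_)) (λ I I⊑T → e _ (outside-⊑⁺ I⊑T))
      (λ I⊑T J⊑T Pa Qa → ∷-injectiveʳ (disj (outside-⊑⁺ I⊑T) (outside-⊑⁺ J⊑T) Pa Qa)))
enum-⊆⁺ (inside ∷ T) P c e disj =
  enum-cong refl
    (λ a → mk⇔ [ (λ (I , I⊑T , Pa) → inside ∷ I , inside-⊑⁺ I⊑T , Pa)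
               , (λ (I , I⊑T , Pa) → outside ∷ I , outside-⊑⁺ I⊑T , Pa) ]′
               (λ { (inside ∷ I , I⊑T , Pa) → inj₁ (I , drop-⊑ (proj₁ I⊑T) , Pa)
                  ; (outside ∷ I , I⊑T , Pa) → inj₂ (I , drop-outside-⊑⁺ I⊑T , Pa) }))
    (enum-⊎
      (enum-⊆ T (P ∘ (inside ∷_)) (c ∘ (inside ∷_)) (λ I I⊑T → e _ (inside-⊑⁺ I⊑T))
        (λ I⊑T J⊑T Pa Qa → ∷-injectiveʳ (disj (inside-⊑⁺ I⊑T) (inside-⊑⁺ J⊑T) Pa Qa)))
      (enum-⊆⁺ T (P ∘ (outside ∷_)) (c ∘ (outside ∷_)) (λ I I⊑T → e _ (outside-⊑⁺ I⊑T))
        (λ I⊑T J⊑T Pa Qa → ∷-injectiveʳ (disj (outside-⊑⁺ I⊑T) (outside-⊑⁺ J⊑T) Pa Qa)))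
      (λ (I , I⊑T , Pa) (J , J⊑T , Qa) → inside≢outside (disj (inside-⊑⁺ I⊑T) (outside-⊑⁺ J⊑T) Pa Qa)))

-- Boolean matrices of decidable relations, and walks

module _ {Q : Fin m → Set} (Q? : Decidable Q) where

  subset : Subset m
  subset = tabulate (does ∘ Q?)

  ∈-subset⁺ : ∀ {v} → Q v → v ∈ₛ subset
  ∈-subset⁺ {v} q = lookup⇒[]= v subset (trans (lookup∘tabulate _ v) (dec-true (Q? v) q))

  ∈-subset⁻ : ∀ {v} → v ∈ₛ subset → Q v
  ∈-subset⁻ {v} v∈ with Q? v | trans (sym (lookup∘tabulate (does ∘ Q?) v)) ([]=⇒lookup v∈)
  ... | yes q | _  = q
  ... | no  _ | ()

Arc? : (O : Matrix m) → ∀ u v → Dec (Arc O u v)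
Arc? O u v = lookup (lookup O u) v Bool.≟ true

module _ {R : Fin m → Fin m → Set} (R? : ∀ u v → Dec (R u v)) where

  matrix : Matrix m
  matrix = tabulate (λ u → subset (R? u))

  Arc-matrix⁺ : ∀ {u v} → R u v → Arc matrix u v
  Arc-matrix⁺ {u} {v} r =
    trans (cong (λ row → lookup row v) (lookup∘tabulate (λ u → subset (R? u)) u))
          ([]=⇒lookup (∈-subset⁺ (R? u) r))

  Arc-matrix⁻ : ∀ {u v} → Arc matrix u v → R u v
  Arc-matrix⁻ {u} {v} arc = ∈-subset⁻ (R? u) (lookup⇒[]= v _
    (trans (cong (λ row → lookup row v) (sym (lookup∘tabulate (λ u → subset (R? u)) u))) arc))

Vec-ext : {xs ys : Vec A m} → lookup xs ≗ lookup ys → xs ≡ ys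
Vec-ext {xs = xs} {ys} e =
  trans (sym (tabulate∘lookup xs)) (trans (tabulate-cong e) (tabulate∘lookup ys))

-- A row is a Boolean vector, hence a `Subset` of out-neighbours, and rows are compared by mutual
-- inclusion.
matrix-ext : {O O′ : Matrix m} → (∀ {u v} → Arc O u v → Arc O′ u v) →
             (∀ {u v} → Arc O′ u v → Arc O u v) → O ≡ O′
matrix-ext f g = Vec-ext λ u →
  ⊆-antisym (λ {v} v∈ → lookup⇒[]= v _ (f ([]=⇒lookup v∈)))
            (λ {v} v∈ → lookup⇒[]= v _ (g ([]=⇒lookup v∈)))

Walk⁺-++ : ∀ {O : Matrix m} {u v w} → Walk⁺ O u v → Walk⁺ O v w → Walk⁺ O u w
Walk⁺-++ (one a)    q = step a q
Walk⁺-++ (step a p) q = step a (Walk⁺-++ p q)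

Walk⁺-map : ∀ {O O′ : Matrix m} → (∀ {u v} → Arc O u v → Arc O′ u v) →
            ∀ {u v} → Walk⁺ O u v → Walk⁺ O′ u v
Walk⁺-map f (one a)    = one (f a)
Walk⁺-map f (step a p) = step (f a) (Walk⁺-map f p)

Walk⁺-last : ∀ {O : Matrix m} {u v} → Walk⁺ O u v → ∃ λ w → Arc O w v
Walk⁺-last (one a)    = _ , a
Walk⁺-last (step _ p) = Walk⁺-last p

-- Removing and restoring the sources of an acyclic orientation

module Multipartite {m N : ℕ} (p : Fin m → Fin N) where

  -- The subgraph induced on S is oriented inside a full m × m matrix, so deleting vertices keeps
  -- the type. Opposite arcs are excluded by `acyclic`, as they form a closed walk of length two.
  record AcyclicOn (S : Subset m) (O : Matrix m) : Set where
    field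
      total   : ∀ {u v} → u ∈ₛ S → v ∈ₛ S → p u ≢ p v → Arc O u v ⊎ Arc O v u
      tail    : ∀ {u v} → Arc O u v → u ∈ₛ S
      head    : ∀ {u v} → Arc O u v → v ∈ₛ S
      proper  : ∀ {u v} → Arc O u v → p u ≢ p v
      acyclic : Acyclic O

  open AcyclicOn

  Source : Subset m → Matrix m → Fin m → Set
  Source S O v = v ∈ₛ S × (∀ u → ¬ Arc O u v)

  Source? : ∀ S O v → Dec (Source S O v)
  Source? S O v = (v ∈? S) ×-dec all? (λ u → ¬? (Arc? O u v))

  -- Acyclicity makes walks a strict partial order on a finite set, which is well-founded; following
  -- arcs backwards therefore ends at a source.
  ∃-source : ∀ {S O} → AcyclicOn S O → Nonempty S → ∃ (Source S O)
  ∃-source {S} {O} ao (v , v∈S) = search (spo-wellFounded walks-spo v) v∈S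
    where
    walks-spo : IsStrictPartialOrder _≡_ (Walk⁺ O)
    walks-spo = record
      { isEquivalence = isEquivalence
      ; irrefl        = λ { refl walk → acyclic ao _ walk }
      ; trans         = Walk⁺-++
      ; <-resp-≈      = (λ { refl walk → walk }) , (λ { refl walk → walk })
      }
    search : ∀ {v} → Acc (Walk⁺ O) v → v ∈ₛ S → ∃ (Source S O)
    search {v} (acc rec) v∈S with any? (λ u → Arc? O u v)
    ... | yes (u , arc) = search (rec (one arc)) (tail ao arc)
    ... | no  ¬arc      = v , v∈S , λ u arc → ¬arc (u , arc)

  -- Sources in different parts would be joined by an arc, and its head would not be a source.
  sources-same-part : ∀ {S O u v} → AcyclicOn S O → Source S O u → Source S O v → p u ≡ p v
  sources-same-part {u = u} {v} ao (u∈S , ¬→u) (v∈S , ¬→v) =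
    decidable-stable (p u ≟ p v) λ pu≢pv →
      [ ¬→v u , ¬→u v ]′ (total ao u∈S v∈S pu≢pv)

  Part : Fin N → Subset m
  Part i = subset (λ v → p v ≟ i)

  -- Since all sources share a part, a single source in part i puts all of them there. The
  -- orientation of the empty set has no source and avoids every part.
  StartsIn AvoidsStart : Fin N → Subset m → Matrix m → Set
  StartsIn    i S O = AcyclicOn S O × ∃ λ v → Source S O v × p v ≡ i
  AvoidsStart i S O = AcyclicOn S O × (∀ v → Source S O v → p v ≢ i)

  -- Adds I, a set of vertices of part i, as the set of sources in front of an
  -- orientation of R.
  module _ (i : Fin N) (I R : Subset m) where

    Prepend : Matrix m → Fin m → Fin m → Set
    Prepend O u v = Arc O u v ⊎ (u ∈ₛ I × v ∈ₛ R × p v ≢ i)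

    Prepend? : ∀ O u v → Dec (Prepend O u v)
    Prepend? O u v = Arc? O u v ⊎-dec (u ∈? I ×-dec (v ∈? R ×-dec ¬? (p v ≟ i)))

    prepend : Matrix m → Matrix m
    prepend O = matrix (Prepend? O)

  -- Removing the arcs that leave I suffices to isolate I, because I will consist of sources, which
  -- no arc enters.
  Restrict : Subset m → Matrix m → Fin m → Fin m → Set
  Restrict I O u v = Arc O u v × u ∉ₛ I

  Restrict? : ∀ I O u v → Dec (Restrict I O u v)
  Restrict? I O u v = Arc? O u v ×-dec ¬? (u ∈? I)

  restrict : Subset m → Matrix m → Matrix m
  restrict I O = matrix (Restrict? I O)

  ∈-─⁻ : ∀ {S I : Subset m} {v} → v ∈ₛ S ─ I → v ∈ₛ S × v ∉ₛ I
  ∈-─⁻ {S} {I} v∈ = p─q⊆p S I v∈ , ─-disjoint S I v∈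
    where
    ─-disjoint : ∀ {m} (S I : Subset m) {v} → v ∈ₛ S ─ I → v ∉ₛ I
    ─-disjoint (_ ∷ S) (inside ∷ I) (there v∈) (there v∈I) = ─-disjoint S I v∈ v∈I
    ─-disjoint (_ ∷ S) (outside ∷ I) (there v∈) (there v∈I) = ─-disjoint S I v∈ v∈I

  module _ {i : Fin N} {S I : Subset m} (I⊑ : I ⊑ S ∩ Part i) where

    private
      R : Subset m
      R = S ─ I

      I⇒S : ∀ {v} → v ∈ₛ I → v ∈ₛ S
      I⇒S v∈I = proj₁ (x∈p∩q⁻ S (Part i) (I⊑ _ v∈I))

      I⇒i : ∀ {v} → v ∈ₛ I → p v ≡ i
      I⇒i v∈I = ∈-subset⁻ (λ v → p v ≟ i) (proj₂ (x∈p∩q⁻ S (Part i) (I⊑ _ v∈I)))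

      split : ∀ {v} → v ∈ₛ S → v ∈ₛ I ⊎ v ∈ₛ R
      split {v} v∈S with v ∈? I
      ... | yes v∈I = inj₁ v∈I
      ... | no  v∉I = inj₂ (x∈p∧x∉q⇒x∈p─q v∈S v∉I)

    -- This is the left inverse required by `enum-image`. The added arcs all leave I, while those of
    -- O start in R and survive.
    restrict-prepend : ∀ {O} → AvoidsStart i R O → restrict I (prepend i I R O) ≡ O
    restrict-prepend {O} (ao , _) = matrix-ext restricted extended
      where
      O⁺ = prepend i I R O
      restricted : ∀ {u v} → Arc (restrict I O⁺) u v → Arc O u v
      restricted arc with arc′ , u∉I ← Arc-matrix⁻ (Restrict? I O⁺) arc
                     with Arc-matrix⁻ (Prepend? i I R O) arc′
      ... | inj₁ arc″      = arc″
      ... | inj₂ (u∈I , _) = contradiction u∈I u∉I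
      extended : ∀ {u v} → Arc O u v → Arc (restrict I O⁺) u v
      extended arc = Arc-matrix⁺ (Restrict? I O⁺)
        (Arc-matrix⁺ (Prepend? i I R O) (inj₁ arc) , proj₂ (∈-─⁻ (tail ao arc)))

    module _ {O : Matrix m} (av : AvoidsStart i R O) where

      private
        ao : AcyclicOn R O
        ao = proj₁ av

        O⁺ : Matrix m
        O⁺ = prepend i I R O

        arc⁺ : ∀ {u v} → Prepend i I R O u v → Arc O⁺ u v
        arc⁺ = Arc-matrix⁺ (Prepend? i I R O)

        arc⁻ : ∀ {u v} → Arc O⁺ u v → Prepend i I R O u v
        arc⁻ = Arc-matrix⁻ (Prepend? i I R O)

        head-R : ∀ {u v} → Arc O⁺ u v → v ∈ₛ R
        head-R arc with arc⁻ arc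
        ... | inj₁ arc′          = head ao arc′
        ... | inj₂ (_ , v∈R , _) = v∈R

        arc-R : ∀ {u v} → u ∈ₛ R → Arc O⁺ u v → Arc O u v
        arc-R u∈R arc with arc⁻ arc
        ... | inj₁ arc′      = arc′
        ... | inj₂ (u∈I , _) = contradiction u∈I (proj₂ (∈-─⁻ u∈R))

        walk-R : ∀ {u v} → u ∈ₛ R → Walk⁺ O⁺ u v → Walk⁺ O u v
        walk-R u∈R (one arc)       = one (arc-R u∈R arc)
        walk-R u∈R (step arc walk) = step (arc-R u∈R arc) (walk-R (head-R arc) walk)

      prepend-acyclicOn : AcyclicOn S O⁺
      prepend-acyclicOn .total {u} {v} u∈S v∈S pu≢pv with split u∈S | split v∈S
      ... | inj₁ u∈I | inj₁ v∈I = contradiction (trans (I⇒i u∈I) (sym (I⇒i v∈I))) pu≢pv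
      ... | inj₁ u∈I | inj₂ v∈R = inj₁ (arc⁺ (inj₂ (u∈I , v∈R , λ pv≡i → pu≢pv (trans (I⇒i u∈I) (sym pv≡i)))))
      ... | inj₂ u∈R | inj₁ v∈I = inj₂ (arc⁺ (inj₂ (v∈I , u∈R , λ pu≡i → pu≢pv (trans pu≡i (sym (I⇒i v∈I))))))
      ... | inj₂ u∈R | inj₂ v∈R = [ inj₁ ∘ arc⁺ ∘ inj₁ , inj₂ ∘ arc⁺ ∘ inj₁ ]′ (total ao u∈R v∈R pu≢pv)
      prepend-acyclicOn .tail arc with arc⁻ arc
      ... | inj₁ arc′      = proj₁ (∈-─⁻ (tail ao arc′))
      ... | inj₂ (u∈I , _) = I⇒S u∈I
      prepend-acyclicOn .head arc = proj₁ (∈-─⁻ (head-R arc))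
      prepend-acyclicOn .proper arc with arc⁻ arc
      ... | inj₁ arc′              = proper ao arc′
      ... | inj₂ (u∈I , _ , pv≢i)  = λ pu≡pv → pv≢i (trans (sym pu≡pv) (I⇒i u∈I))
      -- Every arc of `O⁺` has its head in R, so a closed walk starts in R and never leaves it; it
      -- is then a walk of O.
      prepend-acyclicOn .acyclic v walk =
        acyclic ao v (walk-R (head-R (proj₂ (Walk⁺-last walk))) walk)

      prepend-source⁺ : ∀ {v} → v ∈ₛ I → Source S O⁺ v
      prepend-source⁺ v∈I = I⇒S v∈I , λ u arc → proj₂ (∈-─⁻ (head-R arc)) v∈I

      -- A source in R would also be a source of O. Sharing a part with the sources in I, it would
      -- lie in part i, which O avoids.
      prepend-source⁻ : Nonempty I → ∀ {v} → Source S O⁺ v → v ∈ₛ I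
      prepend-source⁻ (w , w∈I) {v} source@(v∈S , ¬→v) with split v∈S
      ... | inj₁ v∈I = v∈I
      ... | inj₂ v∈R = contradiction
        (trans (sources-same-part prepend-acyclicOn source (prepend-source⁺ w∈I)) (I⇒i w∈I))
        (proj₂ av v (v∈R , λ u arc → ¬→v u (arc⁺ (inj₁ arc))))

      prepend-startsIn : Nonempty I → StartsIn i S O⁺
      prepend-startsIn (w , w∈I) = prepend-acyclicOn , w , prepend-source⁺ w∈I , I⇒i w∈I

  module _ {i : Fin N} {S : Subset m} {O : Matrix m} (starts : StartsIn i S O) where

    private
      ao : AcyclicOn S O
      ao = proj₁ starts

    sources : Subset m
    sources = subset (Source? S O)

    private
      R : Subset m
      R = S ─ sources

      source⁺ : ∀ {v} → Source S O v → v ∈ₛ sources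
      source⁺ = ∈-subset⁺ (Source? S O)

      source⁻ : ∀ {v} → v ∈ₛ sources → Source S O v
      source⁻ = ∈-subset⁻ (Source? S O)

      source⇒i : ∀ {v} → Source S O v → p v ≡ i
      source⇒i source = let _ , _ , source′ , pw≡i = starts in
        trans (sources-same-part ao source source′) pw≡i

      O⁻ : Matrix m
      O⁻ = restrict sources O

      arc⁺ : ∀ {u v} → Restrict sources O u v → Arc O⁻ u v
      arc⁺ = Arc-matrix⁺ (Restrict? sources O)

      arc⁻ : ∀ {u v} → Arc O⁻ u v → Restrict sources O u v
      arc⁻ = Arc-matrix⁻ (Restrict? sources O)

      head-R : ∀ {u v} → Arc O u v → v ∈ₛ R
      head-R arc = x∈p∧x∉q⇒x∈p─q (head ao arc) λ v∈ → proj₂ (source⁻ v∈) _ arc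

    sources-⊑⁺ : sources ⊑⁺ S ∩ Part i
    sources-⊑⁺ =
      (λ v v∈ → let source = source⁻ v∈ in
                x∈p∩q⁺ (proj₁ source , ∈-subset⁺ (λ v → p v ≟ i) (source⇒i source))) ,
      let w , source , _ = proj₂ starts in w , source⁺ source

    -- The deleted sources lie in part i and so send no arcs to part i. A vertex of part i without
    -- incoming arcs in `O⁻` was thus a source of O already, and has been deleted.
    restrict-avoidsStart : AvoidsStart i R O⁻
    restrict-avoidsStart = record
      { total   = λ u∈R v∈R pu≢pv →
          let u∈S , u∉ = ∈-─⁻ u∈R
              v∈S , v∉ = ∈-─⁻ v∈R
          in [ (λ arc → inj₁ (arc⁺ (arc , u∉))) , (λ arc → inj₂ (arc⁺ (arc , v∉))) ]′
               (total ao u∈S v∈S pu≢pv)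
      ; tail    = λ arc → let arc′ , u∉ = arc⁻ arc in x∈p∧x∉q⇒x∈p─q (tail ao arc′) u∉
      ; head    = λ arc → head-R (proj₁ (arc⁻ arc))
      ; proper  = λ arc → proper ao (proj₁ (arc⁻ arc))
      ; acyclic = λ v walk → acyclic ao v (Walk⁺-map (λ arc → proj₁ (arc⁻ arc)) walk)
      } , avoids
      where
      avoids : ∀ v → Source R O⁻ v → p v ≢ i
      avoids v (v∈R , ¬→v) pv≡i with v∈S , v∉ ← ∈-─⁻ v∈R =
        v∉ (source⁺ (v∈S , λ u arc → ¬→v u (arc⁺ (arc , λ u∈ →
          proper ao arc (trans (source⇒i (source⁻ u∈)) (sym pv≡i))))))

    -- The arcs at a source are forced: each edge from it to R points away from it, and these edges
    -- go exactly to the vertices of R outside part i.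
    prepend-restrict : O ≡ prepend i sources R O⁻
    prepend-restrict = matrix-ext to′ from′
      where
      to′ : ∀ {u v} → Arc O u v → Arc (prepend i sources R O⁻) u v
      to′ {u} {v} arc = Arc-matrix⁺ (Prepend? i sources R O⁻) prependArc
        where
        prependArc : Prepend i sources R O⁻ u v
        prependArc with u ∈? sources
        ... | no  u∉ = inj₁ (arc⁺ (arc , u∉))
        ... | yes u∈ = inj₂ (u∈ , head-R arc , λ pv≡i →
          proper ao arc (trans (source⇒i (source⁻ u∈)) (sym pv≡i)))
      from′ : ∀ {u v} → Arc (prepend i sources R O⁻) u v → Arc O u v
      from′ arc with Arc-matrix⁻ (Prepend? i sources R O⁻) arc
      ... | inj₁ arc′ = proj₁ (arc⁻ arc′)
      ... | inj₂ (u∈ , v∈R , pv≢i) with source⁻ u∈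
      ...   | source@(u∈S , ¬→u) =
        [ (λ arc′ → arc′) , (λ arc′ → contradiction arc′ (¬→u _)) ]′
          (total ao u∈S (proj₁ (∈-─⁻ v∈R)) λ pu≡pv → pv≢i (trans (sym pu≡pv) (source⇒i source)))

  Prepended : Fin N → Subset m → Subset m → Matrix m → Set
  Prepended i S I O = ∃ λ O′ → AvoidsStart i (S ─ I) O′ × O ≡ prepend i I (S ─ I) O′

  Prepended⇔StartsIn : ∀ {i S} O → (∃ λ I → I ⊑⁺ S ∩ Part i × Prepended i S I O) ⇔ StartsIn i S O
  Prepended⇔StartsIn O = mk⇔
    (λ { (I , (I⊑ , I≢∅) , O′ , av , refl) → prepend-startsIn I⊑ av I≢∅ })
    (λ starts → sources starts , sources-⊑⁺ starts , _ ,
      restrict-avoidsStart starts , prepend-restrict starts)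

  -- The set I is recovered from O as its set of sources.
  Prepended-disjoint : ∀ {i S I J O} → I ⊑⁺ S ∩ Part i → J ⊑⁺ S ∩ Part i →
                       Prepended i S I O → Prepended i S J O → I ≡ J
  Prepended-disjoint {S = S} (I⊑ , I≢∅) (J⊑ , J≢∅) (O′ , av , refl) (O″ , av′ , eq) = ⊆-antisym
    (λ v∈I → prepend-source⁻ J⊑ av′ J≢∅ (subst (λ O → Source S O _) eq (prepend-source⁺ I⊑ av v∈I)))
    (λ v∈J → prepend-source⁻ I⊑ av I≢∅ (subst (λ O → Source S O _) (sym eq) (prepend-source⁺ J⊑ av′ v∈J)))

-- Counting acyclic orientations by induction on the vertex set

module Counting {m N : ℕ} (p : Fin m → Fin (suc N)) where

  open Multipartite p

  size : Subset m → Fin (suc N) → ℕ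
  size S i = ∣ S ∩ Part i ∣

  size-─ : ∀ {i I} S → size (S ─ I) i ≡ ∣ S ∩ Part i ─ I ∣
  size-─ {i} {I} S = cong ∣_∣ (⊆-antisym
    (λ v∈ → let v∈─ , v∈i = x∈p∩q⁻ (S ─ I) (Part i) v∈
                v∈S , v∉I = ∈-─⁻ v∈─
            in x∈p∧x∉q⇒x∈p─q (x∈p∩q⁺ (v∈S , v∈i)) v∉I)
    (λ v∈ → let v∈∩ , v∉I = ∈-─⁻ v∈
                v∈S , v∈i = x∈p∩q⁻ S (Part i) v∈∩
            in x∈p∩q⁺ (x∈p∧x∉q⇒x∈p─q v∈S v∉I , v∈i)))

  size-─-≢ : ∀ {i j S I} → I ⊑ S ∩ Part i → j ≢ i → size (S ─ I) j ≡ size S j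
  size-─-≢ {i} {j} {S} {I} I⊑ j≢i = cong ∣_∣ (⊆-antisym
    (λ v∈ → let v∈─ , v∈j = x∈p∩q⁻ (S ─ I) (Part j) v∈
            in x∈p∩q⁺ (proj₁ (∈-─⁻ v∈─) , v∈j))
    (λ v∈ → let v∈S , v∈j = x∈p∩q⁻ S (Part j) v∈
            in x∈p∩q⁺ (x∈p∧x∉q⇒x∈p─q v∈S (λ v∈I → j≢i (same-part v∈j v∈I)) , v∈j)))
    where
    same-part : ∀ {v} → v ∈ₛ Part j → v ∈ₛ I → j ≡ i
    same-part v∈j v∈I = trans (sym (∈-subset⁻ (λ v → p v ≟ j) v∈j))
      (∈-subset⁻ (λ v → p v ≟ i) (p∩q⊆q S (Part i) (I⊑ _ v∈I)))

  -- Deleting I lowers only the i-th size, by the number of elements of I, so `∑⊆-pascal` applies in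
  -- factor i. The empty set contributes the `Φ[ i ] (size S)` that is subtracted.
  ∑-Φ[] : ∀ i S → ∑⊆⁺ (S ∩ Part i) (λ I → Φ[ i ] (size (S ─ I))) ≡ Φ (size S) - Φ[ i ] (size S)
  ∑-Φ[] i S = begin
    ∑⊆⁺ T c                          ≡⟨ insert (∑⊆⁺ T c) (c ⊥) ⟩
    (∑⊆⁺ T c + c ⊥) - c ⊥
      ≡⟨ cong₂ _-_ (sym (∑⊆-∑⊆⁺ T c)) (cong (Φ[ i ] ∘ size) (p─⊥≡p S)) ⟩
    ∑⊆ T c - Φ[ i ] (size S)
      ≡⟨ cong (_- Φ[ i ] (size S)) (trans (∑⊆-cong T replace) (∑⊆-pascal E pascal T 0)) ⟩
    E (size S i) 0 - Φ[ i ] (size S) ≡⟨ cong (_- Φ[ i ] (size S)) (∏[≔]-self i α factorial) ⟩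
    Φ (size S) - Φ[ i ] (size S)     ∎
    where
    open ≡-Reasoning
    T : Subset m
    T = S ∩ Part i
    c : Subset m → ℤ
    c I = Φ[ i ] (size (S ─ I))
    α : Fin (suc N) → Functional
    α j = φ (size S j) 0
    E : ℕ → ℕ → ℤ
    E t b = ∏[ i ≔ φ t b ] α ⟨ factorial ⟩
    pascal : ∀ t b → E (suc t) b ≡ E t (suc b) + E t b
    pascal t b = ∏[≔]-additive i α (φ (suc t) b) (φ t (suc b)) (φ t b) (φ-pascal t b) factorial
    insert : ∀ x y → x ≡ (x + y) - y
    insert = solve-∀
    replace : ∀ {I} → I ⊑ T → c I ≡ E 0 (∣ T ─ I ∣)
    replace I⊑T = ∏[≔]-cong i
      (λ j j≢i g → cong (λ n → φ n 0 ⟨ g ⟩) (size-─-≢ I⊑T j≢i))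
      (λ g → cong (λ n → φ 0 n ⟨ g ⟩) (size-─ S)) factorial

  ∈⇒∣∣≢0 : ∀ {S : Subset m} {v} → v ∈ₛ S → ∣ S ∣ ≢ 0
  ∈⇒∣∣≢0 v∈S = ℕ.m<n⇒n≢0 (x∈p⇒∣p-x∣<∣p∣ v∈S)

  edgeless : Matrix m
  edgeless = matrix {R = λ _ _ → Empty} (λ _ _ → no λ ())

  edgeless⇔avoidsStart : ∀ {i S} → ¬ Nonempty S → ∀ O → O ≡ edgeless ⇔ AvoidsStart i S O
  edgeless⇔avoidsStart {S = S} S≡∅ O = mk⇔
    (λ { refl → record
      { total   = λ u∈S → contradiction (_ , u∈S) S≡∅
      ; tail    = λ arc → ⊥-elim (no-arc arc)
      ; head    = λ arc → ⊥-elim (no-arc arc)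
      ; proper  = λ arc → ⊥-elim (no-arc arc)
      ; acyclic = λ v walk → no-arc (proj₂ (Walk⁺-last walk))
      } , λ v (v∈S , _) → contradiction (v , v∈S) S≡∅ })
    (λ (ao , _) → matrix-ext (λ arc → contradiction (_ , AcyclicOn.tail ao arc) S≡∅)
                           (λ arc → ⊥-elim (no-arc arc)))
    where
    no-arc : ∀ {u v} → ¬ Arc edgeless u v
    no-arc {u} {v} = Arc-matrix⁻ {m = m} {R = λ _ _ → Empty} (λ _ _ → no λ ()) {u} {v}

  -- Nonemptiness provides a source. Its part differs from i, so it has the form `punchIn i j`.
  startsElsewhere⇔avoidsStart : ∀ {i S} → Nonempty S → ∀ O →
                                (∃ λ j → StartsIn (punchIn i j) S O) ⇔ AvoidsStart i S O
  startsElsewhere⇔avoidsStart {i} S≢∅ O = mk⇔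
    (λ (j , ao , v , source , pv≡) → ao , λ w source′ pw≡i → punchInᵢ≢i i j
      (trans (sym pv≡) (trans (sources-same-part ao source source′) pw≡i)))
    (λ (ao , avoids) → let v , source = ∃-source ao S≢∅
                           i≢pv = avoids v source ∘ sym
                       in punchOut i≢pv , ao , v , source , sym (punchIn-punchOut i≢pv))

  startsIn⊎avoidsStart⇔ : ∀ {i S} O → (StartsIn i S O ⊎ AvoidsStart i S O) ⇔ AcyclicOn S O
  startsIn⊎avoidsStart⇔ {i} {S} O = mk⇔ [ proj₁ , proj₁ ]′ decide
    where
    decide : AcyclicOn S O → StartsIn i S O ⊎ AvoidsStart i S O
    decide ao with any? (λ v → Source? S O v ×-dec (p v ≟ i))
    ... | yes starts  = inj₁ (ao , starts)
    ... | no  ¬starts = inj₂ (ao , λ v source pv≡i → ¬starts (v , source , pv≡i))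

  -- Mutual induction on the bound k. `count-starts` deletes a nonempty set of sources and lowers k;
  -- `count-avoids` keeps S and k and passes to the other parts.
  count-starts : ∀ k S → ∣ S ∣ < k → ∀ i → Enumeration (StartsIn i S) (Φ (size S) - Φ[ i ] (size S))
  count-avoids : ∀ k S → ∣ S ∣ < k → ∀ i → Enumeration (AvoidsStart i S) (Φ[ i ] (size S))

  count-starts (suc k) S ∣S∣<k i =
    enum-cong (∑-Φ[] i S) Prepended⇔StartsIn
      (enum-⊆⁺ (S ∩ Part i) (Prepended i S) (λ I → Φ[ i ] (size (S ─ I)))
        (λ I I⊑⁺ → enum-image (prepend i I (S ─ I)) (restrict I)
          (restrict-prepend (proj₁ I⊑⁺))
          (count-avoids k (S ─ I) (ℕ.<-≤-trans (smaller I⊑⁺) (ℕ.s≤s⁻¹ ∣S∣<k)) i))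
        Prepended-disjoint)
    where
    smaller : ∀ {I} → I ⊑⁺ S ∩ Part i → ∣ S ─ I ∣ < ∣ S ∣
    smaller {I} (I⊑ , v , v∈I) =
      p∩q≢∅⇒∣p─q∣<∣p∣ S I (v , x∈p∩q⁺ (p∩q⊆p S (Part i) (I⊑ v v∈I) , v∈I))

  count-avoids k S ∣S∣<k i with nonempty? S
  ... | yes S≢∅@(v , v∈S) =
    -- The part of the vertex v of S serves as the part of positive size.
    enum-cong (sum-Φ-Φ[]-except (size S) (p v) i
                (∈⇒∣∣≢0 (x∈p∩q⁺ (v∈S , ∈-subset⁺ (λ w → p w ≟ p v) refl))))
      (startsElsewhere⇔avoidsStart S≢∅)
      (enum-Fin (λ j → StartsIn (punchIn i j) S) _ (λ j → count-starts k S ∣S∣<k (punchIn i j))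
        λ { (ao , _ , source , pv≡j) (_ , _ , source′ , pv′≡j′) → punchIn-injective i _ _
              (trans (sym pv≡j) (trans (sources-same-part ao source source′) pv′≡j′)) })
  ... | no S≡∅ = enum-cong (sym Φ[]≡1) (edgeless⇔avoidsStart S≡∅) (enum-singleton edgeless)
    where
    size≡0 : ∀ j → size S j ≡ 0
    size≡0 j = trans (cong (λ S → ∣ S ∩ Part j ∣) (Empty-unique S≡∅))
                     (trans (cong ∣_∣ (∩-zeroˡ (Part j))) (∣⊥∣≡0 m))
    Φ[]≡1 : Φ[ i ] (size S) ≡ 1ℤ
    Φ[]≡1 = trans (Φ[]-zero i (size S) (size≡0 i)) (Φ-zero (size S) size≡0)

  count-acyclicOn : ∀ S → Enumeration (AcyclicOn S) (Φ (size S))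
  count-acyclicOn S =
    enum-cong (cancel (Φ (size S)) (Φ[ zero ] (size S))) startsIn⊎avoidsStart⇔
      -- The case distinction is whether the sources lie in part `zero`; any other part would do.
      (enum-⊎ (count-starts _ S ℕ.≤-refl zero) (count-avoids _ S ℕ.≤-refl zero)
        λ { (_ , v , source , pv≡i) (_ , avoids) → avoids v source pv≡i })
    where
    cancel : ∀ x y → (x - y) + y ≡ x
    cancel = solve-∀

  -- The right side is `AcyclicOrientation` unfolded, with an arbitrary labelling p in place of
  -- `part sizes`.
  acyclicOn-⊤⇔ : ∀ {S} → (∀ v → v ∈ₛ S) → ∀ O → AcyclicOn S O ⇔
    (((∀ u v → p u ≢ p v → (Arc O u v ⊎ Arc O v u) × ¬ (Arc O u v × Arc O v u)) ×
      (∀ u v → ¬ (p u ≢ p v) → ¬ Arc O u v)) × Acyclic O)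
  acyclicOn-⊤⇔ ∈S O = mk⇔
    (λ ao → ((λ u v pu≢pv → total ao (∈S u) (∈S v) pu≢pv ,
                            λ (arc , arc′) → acyclic ao u (step arc (one arc′))) ,
             (λ u v ¬pu≢pv arc → ¬pu≢pv (proper ao arc))) ,
            acyclic ao)
    (λ ((oriented , supported) , acyc) → record
      { total   = λ _ _ pu≢pv → proj₁ (oriented _ _ pu≢pv)
      ; tail    = λ _ → ∈S _
      ; head    = λ _ → ∈S _
      ; proper  = λ arc pu≡pv → supported _ _ (λ pu≢pv → pu≢pv pu≡pv) arc
      ; acyclic = acyc
      })
    where open AcyclicOn

-- Part sizes of the labelled vertex list

module _ (i : Fin N) where

  -- Counting through `subset` makes this the cardinality of `Part i` by definition when xs is
  -- `partLabels sizes`.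
  occurrences : List (Fin N) → ℕ
  occurrences xs = ∣ subset (λ v → List.lookup xs v ≟ i) ∣

  occurrences-++ : ∀ xs ys → occurrences (xs ++ ys) ≡ occurrences xs ℕ.+ occurrences ys
  occurrences-++ []       ys = refl
  occurrences-++ (x ∷ xs) ys with x ≟ i
  ... | yes _ = cong suc (occurrences-++ xs ys)
  ... | no  _ = occurrences-++ xs ys

  occurrences-replicate : ∀ n → occurrences (replicate n i) ≡ n
  occurrences-replicate zero    = refl
  occurrences-replicate (suc n) with i ≟ i
  ... | yes _   = cong suc (occurrences-replicate n)
  ... | no  i≢i = contradiction refl i≢i

  occurrences-replicate-≢ : ∀ n {j} → j ≢ i → occurrences (replicate n j) ≡ 0
  occurrences-replicate-≢ zero    j≢i = refl
  occurrences-replicate-≢ (suc n) {j} j≢i with j ≟ i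
  ... | yes j≡i = contradiction j≡i j≢i
  ... | no  _   = occurrences-replicate-≢ n j≢i

  -- This generalizes `partLabels`, where h is the identity, because dropping the first block
  -- replaces h by `h ∘ suc`.
  blocks : ∀ {k} → (Fin k → ℕ) → (Fin k → Fin N) → List (Fin N)
  blocks n h = concat (List.tabulate (λ j → replicate (n j) (h j)))

  occurrences-blocks-∉ : ∀ {k} (n : Fin k → ℕ) h → (∀ j → h j ≢ i) → occurrences (blocks n h) ≡ 0
  occurrences-blocks-∉ {zero}  n h h≢i = refl
  occurrences-blocks-∉ {suc k} n h h≢i =
    trans (occurrences-++ (replicate (n zero) (h zero)) (blocks (n ∘ suc) (h ∘ suc)))
          (cong₂ ℕ._+_ (occurrences-replicate-≢ (n zero) (h≢i zero))
                       (occurrences-blocks-∉ (n ∘ suc) (h ∘ suc) (h≢i ∘ suc)))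

  occurrences-blocks : ∀ {k} (n : Fin k → ℕ) h → (∀ {j j′} → h j ≡ h j′ → j ≡ j′) →
                       ∀ j → h j ≡ i → occurrences (blocks n h) ≡ n j
  occurrences-blocks n h h-inj zero refl =
    trans (occurrences-++ (replicate (n zero) (h zero)) (blocks (n ∘ suc) (h ∘ suc)))
    (trans (cong₂ ℕ._+_ (occurrences-replicate (n zero))
                        (occurrences-blocks-∉ (n ∘ suc) (h ∘ suc) (λ j e → Fin.0≢1+n (sym (h-inj e)))))
           (ℕ.+-identityʳ (n zero)))
  occurrences-blocks n h h-inj (suc j) refl =
    trans (occurrences-++ (replicate (n zero) (h zero)) (blocks (n ∘ suc) (h ∘ suc)))
          (cong₂ ℕ._+_ (occurrences-replicate-≢ (n zero) (λ e → Fin.0≢1+n (h-inj e)))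
                       (occurrences-blocks (n ∘ suc) (h ∘ suc) (λ e → Fin.suc-injective (h-inj e)) j refl))

occurrences-partLabels : (ns : Vec ℕ N) (i : Fin N) → occurrences i (partLabels ns) ≡ lookup ns i
occurrences-partLabels ns i =
  trans (cong (occurrences i ∘ concat) (map-tabulate (λ j → j) (λ j → replicate (lookup ns j) j)))
        (occurrences-blocks i (lookup ns) (λ j → j) (λ e → e) i refl)

theorem6p5 : (M : ℕ) (n₁ : ℕ) (ns : Vec ℕ (suc M)) → (∀ i → 1 ≤ lookup ns i) →
    Σ (List (Matrix (V (n₁ ∷ ns)))) λ L →
    Unique L ×
    (∀ O → (O ∈ L) ⇔ AcyclicOrientation (n₁ ∷ ns) O) ×
    (+ length L ≡ formula n₁ (toList ns))
theorem6p5 M n₁ ns 1≤ns =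
  enum-cong (trans (Φ-cong size-⊤) (Φ-formula n₁ ns 1≤ns))
            (acyclicOn-⊤⇔ (λ _ → ∈⊤))
            (count-acyclicOn ⊤)
  where
  open Counting (part (n₁ ∷ ns))
  open Multipartite (part (n₁ ∷ ns)) using (Part)
  size-⊤ : ∀ i → size ⊤ i ≡ lookup (n₁ ∷ ns) i
  size-⊤ i = trans (cong ∣_∣ (∩-identityˡ (Part i))) (occurrences-partLabels (n₁ ∷ ns) i)
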